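{- Let $\mathcal{K}$ be a semi-equivelar map of type $[3^4,10^1]$ on a surface $S$ with Euler characteristic $-2$. Then $\mathcal{K}$ is isomorphic to $\mathcal{K}_1[3^4,10^1]$, $\mathcal{K}_2[3^4,10^1]$, $\mathcal{K}_3[3^4,10^1]$ or $\mathcal{K}_4[3^4,10^1]$, the four explicit maps specified in the context.
   Context: A surface is a connected closed 2-manifold (orientable or not). A map is a connected 2-dimensional cell complex on a surface (equivalently, a cellular embedding of a connected graph). All maps are polyhedral: a non-empty intersection of two distinct faces is either a vertex or an edge. A map is semi-equivelar of type $[3^4,10^1]$ if at every vertex the faces containing it form a cycle consisting of four triangles and one 10-gon. Two maps are isomorphic if there is a bijection between their vertex sets that carries cells (edges, faces) to cells in both directions. The four maps. Each $\mathcal{K}_t[3^4,10^1]$ has vertex set $\{1,\dots,30\}$ and three 10-gonal faces $F_1=[1,2,\dots,10]$, $F_3=[11,12,\dots,20]$, $F_2=[21,22,\dots,30]$. Write $i^+$ for the successor of $i$ in the cyclic order of its 10-gon ($i^+=i+1$, except $10^+=1$, $20^+=11$, $30^+=21$). For each $t$ let $\sigma=\sigma_t$ be the fixed-point-free involution of $\{1,\dots,30\}$ that swaps the two members of each of the following pairs: $t=1$: $\{1,30\},\{3,22\},\{5,26\},\{7,28\},\{9,24\},\{2,13\},\{4,19\},\{6,15\},\{8,17\},\{10,11\},\{12,23\},\{14,29\},\{16,25\},\{18,27\},\{20,21\}$. $t=2$: $\{1,30\},\{3,24\},\{5,28\},\{7,22\},\{9,26\},\{2,13\},\{4,15\},\{6,17\},\{8,19\},\{10,11\},\{12,25\},\{14,29\},\{16,23\},\{18,27\},\{20,21\}$.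 $t=3$: $\{1,30\},\{3,26\},\{5,22\},\{7,24\},\{9,28\},\{2,13\},\{4,17\},\{6,19\},\{8,15\},\{10,11\},\{12,27\},\{14,29\},\{16,23\},\{18,25\},\{20,21\}$. $t=4$: $\{1,30\},\{3,22\},\{5,24\},\{7,26\},\{9,28\},\{2,15\},\{4,19\},\{6,13\},\{8,17\},\{10,11\},\{12,27\},\{14,23\},\{16,29\},\{18,25\},\{20,21\}$. The 40 triangular faces of $\mathcal{K}_t[3^4,10^1]$ are: for each pair $\{i,j\}$ in the list, the two triangles $[i,i^+,j]$ and $[i,j,j^+]$ (30 triangles in total); and the 10 triangles whose vertex sets are the orbits (all of size 3) of the permutation $i\mapsto \sigma(i)^+$ of $\{1,\dots,30\}$ (for instance $[1,11,21]$ for every $t$). -}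

module Defs where

open import Data.Fin using (Fin)
import Data.Fin.Properties as Fin
open import Data.Integer as ℤ using (ℤ; +_)
open import Data.List
  using (List; []; _∷_; _∷ʳ_; _++_; map; zip; length; lookup; filter; concatMap;
         allFin; cartesianProduct; upTo)
open import Data.List.Membership.Propositional using (_∈_)
import Data.List.Membership.DecPropositional as DecMembership
open import Data.List.Relation.Binary.Pointwise using (Pointwise)
open import Data.List.Relation.Unary.Unique.Propositional using (Unique)
open import Data.Nat as ℕ using (ℕ; suc; _∸_; _≤_; _<_; _≤?_; _≡ᵇ_)
open import Data.Nat.DivMod using (_mod_; _%_)
open import Data.Bool using (if_then_else_)
open import Data.Product using (_×_; _,_; Σ-syntax; ∃-syntax; proj₁; proj₂)
open import Data.Product.Properties using (≡-dec)
open import Data.Sum using (_⊎_)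
open import Function.Base using (_∘_)
open import Function.Bundles using (_⇔_; _↔_; module Inverse)
open import Relation.Binary.Construct.Closure.ReflexiveTransitive using (Star)
open import Relation.Binary.PropositionalEquality using (_≡_; _≢_)
open import Relation.Nullary using (¬_; Dec)
open import Relation.Nullary.Decidable using (_×-dec_; _⊎-dec_)

------------------------------------------------------------------------
-- Polygons as cyclic sequences of vertices

-- The oriented sides of the closed polygon x₀ x₁ … xₖ :
-- (x₀ , x₁) , (x₁ , x₂) , … , (xₖ , x₀).
sides : {A : Set} → List A → List (A × A)
sides []       = []
sides (x ∷ xs) = zip (x ∷ xs) (xs ∷ʳ x)

Side : {A : Set} → List A → A → A → Set
Side c x y = (x , y) ∈ sides c ⊎ (y , x) ∈ sides c

-- a and b are the two neighbours of v along c.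
Corner : {A : Set} → List A → A → A → A → Set
Corner c a v b = ((a , v) ∈ sides c × (v , b) ∈ sides c)
               ⊎ ((b , v) ∈ sides c × (v , a) ∈ sides c)

-- For φ a bijection on vertices: φ maps the polygon c onto the polygon d.
-- Starting point and direction of the sequences are irrelevant.
Carries : {A B : Set} → (A → B) → List A → List B → Set
Carries φ c d = (∀ x → x ∈ c ⇔ φ x ∈ d)
              × (∀ x y → Side c x y ⇔ Side d (φ x) (φ y))

------------------------------------------------------------------------
-- Polygonal complexes and polyhedral maps

-- Each face is given by its boundary, a cyclic sequence of vertices; the
-- edges are the sides of the faces.
record Complex : Set where
  field
    vertexCount : ℕ
    faceCount   : ℕ
    face        : Fin faceCount → List (Fin vertexCount)

  Vertex : Set
  Vertex = Fin vertexCount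

  Face : Set
  Face = Fin faceCount

  Edge : Vertex → Vertex → Set
  Edge x y = ∃[ f ] Side (face f) x y

  side? : ∀ f x y → Dec (Side (face f) x y)
  side? f x y = ((x , y) ∈? sides (face f)) ⊎-dec ((y , x) ∈? sides (face f))
    where open DecMembership (≡-dec (Fin._≟_ {vertexCount}) Fin._≟_) using (_∈?_)

  edge? : ∀ x y → Dec (Edge x y)
  edge? x y = Fin.any? λ f → side? f x y

  -- Each edge is listed once, with its smaller endpoint first.
  edges : List (Vertex × Vertex)
  edges = filter (λ e → (proj₁ e Fin.<? proj₂ e) ×-dec edge? (proj₁ e) (proj₂ e))
                 (cartesianProduct (allFin vertexCount) (allFin vertexCount))

  eulerCharacteristic : ℤ
  eulerCharacteristic = + vertexCount ℤ.- + length edges ℤ.+ + faceCount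

  -- The faces containing v, arranged in a cycle around v.  With
  -- link = w₀ w₁ … wₖ, the i-th face has the corner wᵢ v wᵢ₊₁ (indices
  -- cyclic), so that consecutive faces share the edge v wᵢ₊₁.
  record FaceCycle (v : Vertex) : Set where
    field
      faces        : List Face
      link         : List Vertex
      nonempty     : 0 < length faces
      faces-unique : Unique faces
      link-unique  : Unique link
      complete     : ∀ f → v ∈ face f → f ∈ faces
      corners      : Pointwise (λ f (a , b) → Corner (face f) a v b) faces (sides link)

  Common : Face → Face → Vertex → Set
  Common f g x = x ∈ face f × x ∈ face g

  -- The intersection of f and g is empty, a vertex, or an edge.
  MeetProperly : Face → Face → Set
  MeetProperly f g =
      (∀ x → ¬ Common f g x)
    ⊎ (∃[ v ] ∀ x → Common f g x ⇔ x ≡ v)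
    ⊎ (∃[ u ] ∃[ v ] Side (face f) u v × Side (face g) u v
                   × (∀ x → Common f g x ⇔ (x ≡ u ⊎ x ≡ v)))

  -- A polyhedral map on a connected closed surface.  A complex of polygons
  -- glued along sides is a closed 2-manifold exactly when the faces around
  -- each vertex form a single cycle; no orientability is imposed.
  record IsPolyhedralMap : Set where
    field
      inhabited  : 0 < vertexCount
      polygonal  : ∀ f → 3 ≤ length (face f) × Unique (face f)
      manifold   : ∀ v → FaceCycle v
      connected  : ∀ x y → Star Edge x y
      polyhedral : ∀ f g → f ≢ g → MeetProperly f g

  -- Around every vertex the sizes of the faces are, in cyclic order, ps.
  -- (The starting point and direction of a face cycle are free.)
  SemiEquivelar : List ℕ → Set
  SemiEquivelar ps =
    ∀ v → Σ[ c ∈ FaceCycle v ] map (length ∘ face) (FaceCycle.faces c) ≡ ps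

infix 4 _≅_

record _≅_ (K L : Complex) : Set where
  private
    module K = Complex K
    module L = Complex L
  field
    bijection : K.Vertex ↔ L.Vertex
  open Inverse bijection using (to)
  field
    edges⇔ : ∀ x y → K.Edge x y ⇔ L.Edge (to x) (to y)
    faces⇒ : ∀ f → ∃[ g ] Carries to (K.face f) (L.face g)
    faces⇐ : ∀ g → ∃[ f ] Carries to (K.face f) (L.face g)

------------------------------------------------------------------------
-- The four maps of type [3⁴,10¹], on vertex labels 1 , … , 30

labels : List ℕ
labels = map suc (upTo 30)

-- Successor of a label in the cyclic order of its 10-gon.
_⁺ : ℕ → ℕ
i ⁺ = if i % 10 ≡ᵇ 0 then i ∸ 9 else suc i

-- The involution swapping the members of each listed pair.
swap : List (ℕ × ℕ) → ℕ → ℕ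
swap []             i = i
swap ((a , b) ∷ ps) i =
  if i ≡ᵇ a then b else if i ≡ᵇ b then a else swap ps i

decagons : List (List ℕ)
decagons = map (λ k → map (λ i → suc (k ℕ.+ i)) (upTo 10)) (0 ∷ 10 ∷ 20 ∷ [])

pairTriangles : List (ℕ × ℕ) → List (List ℕ)
pairTriangles = concatMap λ (i , j) → (i ∷ i ⁺ ∷ j ∷ []) ∷ (i ∷ j ∷ j ⁺ ∷ []) ∷ []

-- The orbits of i ↦ (swap ps i)⁺, all of size 3 for the pairs below; each
-- is listed once, starting at its least element.
orbitTriangles : List (ℕ × ℕ) → List (List ℕ)
orbitTriangles ps =
  map (λ i → i ∷ ρ i ∷ ρ (ρ i) ∷ [])
      (filter (λ i → (i ≤? ρ i) ×-dec (i ≤? ρ (ρ i))) labels)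
  where
  ρ : ℕ → ℕ
  ρ i = (swap ps i) ⁺

labelledFaces : List (ℕ × ℕ) → List (List ℕ)
labelledFaces ps = decagons ++ pairTriangles ps ++ orbitTriangles ps

-- Label i is the vertex with index i ∸ 1.
𝒦 : List (ℕ × ℕ) → Complex
𝒦 ps = record
  { vertexCount = 30
  ; faceCount   = length (labelledFaces ps)
  ; face        = λ f → map (λ i → (i ∸ 1) mod 30) (lookup (labelledFaces ps) f)
  }

pairs₁ : List (ℕ × ℕ)
pairs₁ =
    (1 , 30) ∷ (3 , 22) ∷ (5 , 26) ∷ (7 , 28) ∷ (9 , 24)
  ∷ (2 , 13) ∷ (4 , 19) ∷ (6 , 15) ∷ (8 , 17) ∷ (10 , 11)
  ∷ (12 , 23) ∷ (14 , 29) ∷ (16 , 25) ∷ (18 , 27) ∷ (20 , 21)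
  ∷ []

pairs₂ : List (ℕ × ℕ)
pairs₂ =
    (1 , 30) ∷ (3 , 24) ∷ (5 , 28) ∷ (7 , 22) ∷ (9 , 26)
  ∷ (2 , 13) ∷ (4 , 15) ∷ (6 , 17) ∷ (8 , 19) ∷ (10 , 11)
  ∷ (12 , 25) ∷ (14 , 29) ∷ (16 , 23) ∷ (18 , 27) ∷ (20 , 21)
  ∷ []

pairs₃ : List (ℕ × ℕ)
pairs₃ =
    (1 , 30) ∷ (3 , 26) ∷ (5 , 22) ∷ (7 , 24) ∷ (9 , 28)
  ∷ (2 , 13) ∷ (4 , 17) ∷ (6 , 19) ∷ (8 , 15) ∷ (10 , 11)
  ∷ (12 , 27) ∷ (14 , 29) ∷ (16 , 23) ∷ (18 , 25) ∷ (20 , 21)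
  ∷ []

pairs₄ : List (ℕ × ℕ)
pairs₄ =
    (1 , 30) ∷ (3 , 22) ∷ (5 , 24) ∷ (7 , 26) ∷ (9 , 28)
  ∷ (2 , 15) ∷ (4 , 19) ∷ (6 , 13) ∷ (8 , 17) ∷ (10 , 11)
  ∷ (12 , 27) ∷ (14 , 23) ∷ (16 , 29) ∷ (18 , 25) ∷ (20 , 21)
  ∷ []

𝒦₁ 𝒦₂ 𝒦₃ 𝒦₄ : Complex
𝒦₁ = 𝒦 pairs₁
𝒦₂ = 𝒦 pairs₂
𝒦₃ = 𝒦 pairs₃
𝒦₄ = 𝒦 pairs₄

module Submission where

-- A decagon side lies in one triangle; call the third vertex its apex. Two sides with the same
-- apex v would fill the space around a neighbour of v with two triangles, so apexes are distinct,
-- and as there are as many sides as vertices, every vertex v is the apex of exactly one side.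
-- The triangle on that side shares an edge with one of the two triangles on sides at v, which
-- selects a side {v , next v} at v. The selection is coherent along each decagon, so the map is
-- the snub of an oriented map of type {3,10}: next has order 10, the apex σ v of {v , next v}
-- defines an involution, and ρ = next ∘ σ has order 3, its orbits being the triangles that touch
-- three decagons.
--
-- Euler characteristic -2 gives 30 vertices, hence three decagons, and the vertices are
-- nextⁱ (ρᵈ v) with d < 3 and i < 10. The sides of a decagon face the other two decagons
-- alternately, so ρ maps even positions of decagon d to even positions of decagon d + 1, and
-- two permutations α and β of ℤ/5 fixing 0 describe σ. The relation ρ³ = 1 leaves eight pairs
-- (α , β). Each of them is read off 𝒦₁ or 𝒦₂ from a suitable vertex; 𝒦₃ ≅ 𝒦₁ and 𝒦₄ ≅ 𝒦₂, so
-- these two maps suffice.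

open import Defs
open import Data.Bool using (true; false; if_then_else_)
open import Data.Empty using (⊥; ⊥-elim)
open import Data.Fin as Fin using (Fin; toℕ; zero; suc; fromℕ<; inject₁; opposite; combine; remQuot)
open import Data.Fin.Patterns
open import Data.Fin.Properties as Fin
  using (all?; any?; pigeonhole; toℕ-injective; toℕ<n; toℕ-fromℕ<; combine-remQuot; opposite-involutive)
import Data.Integer as ℤ
import Data.Integer.Properties as ℤ
open import Data.Integer.Tactic.RingSolver using () renaming (solve-∀ to solve-∀ᶻ)
open import Data.List
  using (List; []; _∷_; _∷ʳ_; _++_; [_]; length; zip; lookup; map; tabulate; filter;
         cartesianProduct; allFin; replicate)
open import Data.List.Membership.Propositional using (_∈_; _∉_)
import Data.List.Membership.DecPropositional as DecMembership
open import Data.List.Membership.Propositional.Properties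
  using (∈-∃++; ∈-++⁻; ∈-++⁺ˡ; ∈-++⁺ʳ; ∈-lookup; ∈-map⁺; ∈-map⁻; ∈-tabulate⁺; ∈-tabulate⁻)
open import Data.List.Properties using (length-++; map-++; map-∘; map-tabulate)
open import Data.List.Relation.Binary.Pointwise using (Pointwise; []; _∷_)
open import Data.List.Relation.Binary.Subset.Propositional using (_⊆_)
open import Data.List.Relation.Unary.All as All using (All; []; _∷_)
open import Data.List.Relation.Unary.AllPairs using ([]; _∷_)
open import Data.List.Relation.Unary.Any as Any using (here; there)
open import Data.List.Relation.Unary.Any.Properties using (lookup-index)
open import Data.List.Relation.Unary.Unique.Propositional using (Unique)
import Data.List.Relation.Unary.Unique.DecPropositional as DecUnique
open import Data.List.Relation.Unary.Unique.Propositional.Properties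
  using (Unique[x∷xs]⇒x∉xs; tabulate⁺)
open import Data.Nat as ℕ using (ℕ; zero; suc; _+_; _*_; _∸_; _≤_; _<_; z≤n; s≤s)
open import Data.Nat.DivMod using (_mod_; _%_; _/_; m≡m%n+[m/n]*n; m%n<n)
open import Data.Nat.GeneralisedArithmetic using (fold; fold-+)
open import Data.Nat.ListAction using () renaming (sum to sumᴸ)
open import Data.Nat.ListAction.Properties using (sum-++)
import Data.Nat.Properties as ℕ
open import Data.Nat.Tactic.RingSolver using (solve-∀)
open import Data.Product as Product using (_×_; _,_; proj₁; proj₂; ∃; ∃₂; ∃-syntax; map₂)
open import Data.Sum as Sum using (_⊎_; inj₁; inj₂; [_,_]′)
open import Data.Vec as Vec using (Vec; []; _∷_)
open import Data.Vec.Properties using (lookup∘tabulate)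
open import Function.Base using (_∘_; id)
open import Function.Bundles using (_⇔_; mk⇔; module Equivalence; mk↔ₛ′)
open import Function.Properties.Equivalence using () renaming (trans to ⇔-trans; sym to ⇔-sym)
open import Relation.Binary.Definitions using (tri<; tri≈; tri>)
open import Relation.Binary.PropositionalEquality hiding ([_])
open import Relation.Nullary using (¬_; Dec; yes; no; does)
open import Relation.Nullary.Decidable
  using (_×-dec_; _⊎-dec_; _→-dec_; ¬?; map′; toWitness; True; dec-true; dec-false; does-⇔)
open import Algebra.Properties.CommutativeMonoid.Sum ℕ.+-0-commutativeMonoid
  using (sum; ∑-comm; ∑-distrib-+; sum-cong-≗)

-- Lists and closed polygons

module _ {A : Set} where

  -- Induction: the head of `xs` is cut out of `ys` and the remainders are compared. This is how
  -- three distinct known corners exhaust a face of length 3.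
  ⊆-pigeonhole : {xs ys : List A} → Unique xs → xs ⊆ ys → length ys ≤ length xs → ys ⊆ xs
  ⊆-pigeonhole {[]}     {[]} _ _ _ ()
  ⊆-pigeonhole {x ∷ xs} u@(_ ∷ u′) xs⊆ys len with ∈-∃++ (xs⊆ys (here refl))
  ... | as , bs , refl = conclude
    where
    rest : xs ⊆ as ++ bs
    rest w with ∈-++⁻ as (xs⊆ys (there w))
    ... | inj₁ p         = ∈-++⁺ˡ p
    ... | inj₂ (here refl) = ⊥-elim (Unique[x∷xs]⇒x∉xs u w)
    ... | inj₂ (there p) = ∈-++⁺ʳ as p

    shorter : length (as ++ bs) ≤ length xs
    shorter = ℕ.≤-pred (subst (ℕ._≤ _) (trans (length-++ as) (trans (ℕ.+-suc _ _)
                 (cong suc (sym (length-++ as))))) len)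

    conclude : as ++ [ x ] ++ bs ⊆ x ∷ xs
    conclude p with ∈-++⁻ as p
    ... | inj₁ q         = there (⊆-pigeonhole u′ rest shorter (∈-++⁺ˡ q))
    ... | inj₂ (here q)  = here q
    ... | inj₂ (there q) = there (⊆-pigeonhole u′ rest shorter (∈-++⁺ʳ as q))

  lookup-injective : {xs : List A} → Unique xs → ∀ i j → lookup xs i ≡ lookup xs j → i ≡ j
  lookup-injective (x≢ ∷ u) zero    zero    _  = refl
  lookup-injective (x≢ ∷ u) zero    (suc j) eq = ⊥-elim (All.lookup x≢ (∈-lookup j) eq)
  lookup-injective (x≢ ∷ u) (suc i) zero    eq = ⊥-elim (All.lookup x≢ (∈-lookup i) (sym eq))
  lookup-injective (x≢ ∷ u) (suc i) (suc j) eq = cong suc (lookup-injective u i j eq)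

  zip-∈ : {xs ys : List A} {x y : A} → (x , y) ∈ zip xs ys → x ∈ xs × y ∈ ys
  zip-∈ {_ ∷ _} {_ ∷ _} (here refl) = here refl , here refl
  zip-∈ {_ ∷ _} {_ ∷ _} (there p)   = Product.map there there (zip-∈ p)

  zip-functional : {xs ys : List A} {x y z : A} → Unique xs →
                   (x , y) ∈ zip xs ys → (x , z) ∈ zip xs ys → y ≡ z
  zip-functional {_ ∷ _} {_ ∷ _} _ (here refl) (here refl) = refl
  zip-functional {_ ∷ _} {_ ∷ _} u (here refl) (there q)   = ⊥-elim (Unique[x∷xs]⇒x∉xs u (proj₁ (zip-∈ q)))
  zip-functional {_ ∷ _} {_ ∷ _} u (there p)   (here refl) = ⊥-elim (Unique[x∷xs]⇒x∉xs u (proj₁ (zip-∈ p)))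
  zip-functional {_ ∷ _} {_ ∷ _} (_ ∷ u) (there p) (there q) = zip-functional u p q

  zip-injective : {xs ys : List A} {x y z : A} → Unique ys →
                  (x , z) ∈ zip xs ys → (y , z) ∈ zip xs ys → x ≡ y
  zip-injective {_ ∷ _} {_ ∷ _} _ (here refl) (here refl) = refl
  zip-injective {_ ∷ _} {_ ∷ _} u (here refl) (there q)   = ⊥-elim (Unique[x∷xs]⇒x∉xs u (proj₂ (zip-∈ q)))
  zip-injective {_ ∷ _} {_ ∷ _} u (there p)   (here refl) = ⊥-elim (Unique[x∷xs]⇒x∉xs u (proj₂ (zip-∈ p)))
  zip-injective {_ ∷ _} {_ ∷ _} (_ ∷ u) (there p) (there q) = zip-injective u p q

  ∈-∷ʳ⁻ : ∀ {x y : A} xs → y ∈ xs ∷ʳ x → y ∈ x ∷ xs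
  ∈-∷ʳ⁻ xs p with ∈-++⁻ xs p
  ... | inj₁ q        = there q
  ... | inj₂ (here q) = here q

  unique-∷ʳ : ∀ {x : A} {xs} → Unique (x ∷ xs) → Unique (xs ∷ʳ x)
  unique-∷ʳ {xs = []}     u = u
  unique-∷ʳ {xs = y ∷ xs} ((x≢y ∷ x≢xs) ∷ (y≢xs ∷ u)) =
    All.tabulate y≢ ∷ unique-∷ʳ (x≢xs ∷ u)
    where
    y≢ : ∀ {z} → z ∈ xs ∷ʳ _ → y ≢ z
    y≢ p with ∈-∷ʳ⁻ xs p
    ... | here refl = ≢-sym x≢y
    ... | there q   = All.lookup y≢xs q

  sides-∈ : ∀ c {x y : A} → (x , y) ∈ sides c → x ∈ c × y ∈ c
  sides-∈ (_ ∷ xs) p = Product.map id (∈-∷ʳ⁻ xs) (zip-∈ p)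

  sides-functional : ∀ {c} {x y z : A} → Unique c → (x , y) ∈ sides c → (x , z) ∈ sides c → y ≡ z
  sides-functional {_ ∷ _} u = zip-functional u

  sides-injective : ∀ {c} {x y z : A} → Unique c → (x , z) ∈ sides c → (y , z) ∈ sides c → x ≡ y
  sides-injective {_ ∷ _} u = zip-injective (unique-∷ʳ u)

  ∈-sides : ∀ {c} {x : A} → x ∈ c → ∃[ y ] (x , y) ∈ sides c
  ∈-sides {_ ∷ xs} = go xs
    where
    go : ∀ {x y z : A} xs → x ∈ y ∷ xs → ∃[ w ] (x , w) ∈ zip (y ∷ xs) (xs ∷ʳ z)
    go []       (here refl) = _ , here refl
    go (_ ∷ _)  (here refl) = _ , here refl
    go (_ ∷ xs) (there p)   = map₂ there (go xs p)

  sides-irreflexive : ∀ {c} {x : A} → Unique c → 2 ≤ length c → (x , x) ∉ sides c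
  sides-irreflexive {_ ∷ []}     _ (s≤s ())
  sides-irreflexive {_ ∷ _ ∷ _}  ((x≢ ∷ _) ∷ _) _ (here refl) = x≢ refl
  sides-irreflexive {z ∷ y ∷ xs} u@(_ ∷ u′) _ (there p) = go u′ (Unique[x∷xs]⇒x∉xs u) p
    where
    go : ∀ {x y xs} → Unique (y ∷ xs) → z ∉ y ∷ xs → (x , x) ∉ zip (y ∷ xs) (xs ∷ʳ z)
    go {xs = []}    _ z∉ (here refl) = z∉ (here refl)
    go {xs = _ ∷ _} ((y≢ ∷ _) ∷ _) _ (here refl) = y≢ refl
    go {xs = _ ∷ _} (_ ∷ u) z∉ (there p) = go u (z∉ ∘ there) p

  fold-suc : ∀ (f : A → A) x i → fold (f x) f i ≡ f (fold x f i)
  fold-suc f x zero    = refl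
  fold-suc f x (suc i) = cong f (fold-suc f x i)

  fold-cancel : ∀ {f : A → A} → (∀ {x y} → f x ≡ f y → x ≡ y) →
                ∀ {x y} i → fold x f i ≡ fold y f i → x ≡ y
  fold-cancel f-injective zero    eq = eq
  fold-cancel f-injective (suc i) eq = fold-cancel f-injective i (f-injective eq)

  -- The consecutive sides turn the entries into iterates of `f`; the closing side, from the last
  -- entry back to `x`, gives the period.
  sides-orbit : ∀ (f : A → A) x xs → All (λ (a , b) → f a ≡ b) (sides (x ∷ xs)) →
                (∀ i → lookup (x ∷ xs) i ≡ fold x f (toℕ i)) × fold x f (suc (length xs)) ≡ x
  sides-orbit f x xs = go x xs
    where
    go : ∀ {z} y ys → All (λ (a , b) → f a ≡ b) (zip (y ∷ ys) (ys ∷ʳ z)) →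
         (∀ i → lookup (y ∷ ys) i ≡ fold y f (toℕ i)) × fold y f (suc (length ys)) ≡ z
    go y []       (fy≡z ∷ []) = (λ { zero → refl }) , fy≡z
    go y (w ∷ ys) (refl ∷ p)  with go w ys p
    ... | lookups , closes =
      (λ { zero → refl ; (suc i) → trans (lookups i) (fold-suc f y (toℕ i)) }) ,
      trans (sym (cong f (fold-suc f y (length ys)))) closes

-- Maps given by a rotation

-- The elements of `A` play the role of the darts of the oriented map of type {3,10}: `next` turns
-- about a vertex, `σ` reverses a dart, and `ρ` runs around a triangular face.
record Rotation (A : Set) : Set where
  field
    next σ : A → A

  ρ : A → A
  ρ x = next (σ x)

-- `aperiodic` excludes the periods 1 to 9. `decagonOf` is a labelling constant along `next`; that
-- equal labels mean the same `next`-orbit follows later from the count of 30 vertices.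
record Laws {A : Set} (R : Rotation A) : Set₁ where
  open Rotation R
  field
    next¹⁰         : ∀ x → fold x next 10 ≡ x
    σ²             : ∀ x → σ (σ x) ≡ x
    ρ³             : ∀ x → ρ (ρ (ρ x)) ≡ x
    aperiodic      : ∀ x (i : Fin 9) → fold x next (suc (toℕ i)) ≢ x
    {Decagon}      : Set
    decagonOf      : A → Decagon
    decagonOf-next : ∀ x → decagonOf (next x) ≡ decagonOf x
    decagonOf-ρ    : ∀ x → decagonOf (ρ x) ≢ decagonOf x

data Kind : Set where
  decagon edgeTriangle orbitTriangle : Kind

module _ {A : Set} (R : Rotation A) where
  open Rotation R

  Members : Kind → A → A → Set
  Members decagon       v x = ∃[ i ] fold v next i ≡ x
  Members edgeTriangle  v x = x ∈ v ∷ next v ∷ σ v ∷ []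
  Members orbitTriangle v x = x ∈ v ∷ ρ v ∷ ρ (ρ v) ∷ []

  -- Any two distinct vertices of a triangle are adjacent, so only the decagons refer to `next`. As
  -- in `Side`, no direction is recorded.
  Adjacent : Kind → A → A → A → Set
  Adjacent decagon v x y = (Members decagon v x × next x ≡ y) ⊎ (Members decagon v y × next y ≡ x)
  Adjacent k       v x y = Members k v x × Members k v y × x ≢ y

  -- The two fields mirror the two conditions of `Carries`, with one polygon replaced by a
  -- description in terms of `R`. A bijection compatible with the rotations therefore carries faces
  -- to faces.
  record IsFace (k : Kind) (v : A) (c : List A) : Set where
    field
      members : ∀ x → x ∈ c ⇔ Members k v x
      sides⇔  : ∀ x y → Side c x y ⇔ Adjacent k v x y

record IsSnub (K : Complex) (R : Rotation (Complex.Vertex K)) : Set where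
  open Complex K
  open Rotation R
  field
    face⇒ : ∀ f → ∃₂ λ k v → IsFace R k v (face f)
    face⇐ : ∀ k v → ∃[ f ] IsFace R k v (face f)

module _ {A : Set} {f : A → A} {n : ℕ} (period : ∀ x → fold x f n ≡ x) where

  fold-multiple : ∀ m x → fold x f (m * n) ≡ x
  fold-multiple zero    x = refl
  fold-multiple (suc m) x = begin
    fold x f (n + m * n)        ≡⟨ fold-+ x f n ⟩
    fold (fold x f (m * n)) f n ≡⟨ period _ ⟩
    fold x f (m * n)            ≡⟨ fold-multiple m x ⟩
    x                           ∎
    where open ≡-Reasoning

record Triangle {A : Set} (c : List A) (x y z : A) : Set where
  constructor triangle
  field
    corners  : All (_∈ c) (x ∷ y ∷ z ∷ [])
    distinct : Unique (x ∷ y ∷ z ∷ [])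
    size     : length c ≡ 3

module _ {A : Set} {c : List A} {x y z : A} (t : Triangle c x y z) where
  open Triangle t

  triangle-∈⁻ : ∀ {u} → u ∈ c → u ∈ x ∷ y ∷ z ∷ []
  triangle-∈⁻ = ⊆-pigeonhole distinct (All.lookup corners) (ℕ.≤-reflexive size)

  triangle-∈ : ∀ u → u ∈ c ⇔ u ∈ x ∷ y ∷ z ∷ []
  triangle-∈ u = mk⇔ triangle-∈⁻ (All.lookup corners)

triangle-Side : {A : Set} {c : List A} → length c ≡ 3 → Unique c →
                ∀ u w → Side c u w ⇔ (u ∈ c × w ∈ c × u ≢ w)
triangle-Side {c = c@(p ∷ q ∷ r ∷ [])} refl unique u w = mk⇔ to from
  where
  irreflexive : (u , u) ∉ sides c
  irreflexive = sides-irreflexive unique (s≤s (s≤s z≤n))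

  to : Side c u w → u ∈ c × w ∈ c × u ≢ w
  to (inj₁ s) = let u∈ , w∈ = sides-∈ c s in u∈ , w∈ , λ { refl → irreflexive s }
  to (inj₂ s) = let w∈ , u∈ = sides-∈ c s in u∈ , w∈ , λ { refl → irreflexive s }

  from : u ∈ c × w ∈ c × u ≢ w → Side c u w
  from (here refl , here refl , u≢w) = ⊥-elim (u≢w refl)
  from (here refl , there (here refl) , _) = inj₁ (here refl)
  from (here refl , there (there (here refl)) , _) = inj₂ (there (there (here refl)))
  from (there (here refl) , here refl , _) = inj₂ (here refl)
  from (there (here refl) , there (here refl) , u≢w) = ⊥-elim (u≢w refl)
  from (there (here refl) , there (there (here refl)) , _) = inj₁ (there (here refl))
  from (there (there (here refl)) , here refl , _) = inj₁ (there (there (here refl)))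
  from (there (there (here refl)) , there (here refl) , _) = inj₂ (there (here refl))
  from (there (there (here refl)) , there (there (here refl)) , u≢w) = ⊥-elim (u≢w refl)

module _ {A : Set} {c : List A} (unique : Unique c) (M : A → Set)
         (size : length c ≡ 3) (members : ∀ x → x ∈ c ⇔ M x) where
  open Equivalence

  triangle-Adjacent : ∀ x y → Side c x y ⇔ (M x × M y × x ≢ y)
  triangle-Adjacent x y = mk⇔
    (λ s → let x∈ , y∈ , x≢y = to (triangle-Side size unique x y) s
           in to (members x) x∈ , to (members y) y∈ , x≢y)
    (λ (Mx , My , x≢y) → from (triangle-Side size unique x y) (from (members x) Mx , from (members y) My , x≢y))

module _ {A : Set} (R : Rotation A) where
  open Rotation R

  -- A decidable description of the faces, sufficient for IsFace.
  Code : Kind → A → List A → Set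
  Code decagon       v c = v ∈ c × length c ≡ 10 × All (λ (x , y) → next x ≡ y) (sides c)
  Code edgeTriangle  v c = Triangle c v (next v) (σ v)
  Code orbitTriangle v c = Triangle c v (ρ v) (ρ (ρ v))

  module _ (next¹⁰ : ∀ x → fold x next 10 ≡ x) where

    oriented-decagon : ∀ {v c} → Code decagon v c → IsFace R decagon v c
    oriented-decagon {v} {c@(x₀ ∷ xs)} (v∈c , _ , oriented) = record
      { members = λ x → mk⇔ reach stay ; sides⇔ = λ x y → mk⇔ to from }
      where
      open ≡-Reasoning

      exponents : ∀ i j → i + j * 9 + j ≡ i + j * 10
      exponents = solve-∀

      next-∈ : ∀ {x} → x ∈ c → (x , next x) ∈ sides c
      next-∈ x∈c with ∈-sides x∈c
      ... | y , s with All.lookup oriented s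
      ... | refl = s

      stay : ∀ {x} → Members R decagon v x → x ∈ c
      stay (zero , refl)  = v∈c
      stay (suc i , refl) = proj₂ (sides-∈ c (next-∈ (stay (i , refl))))

      position : ∀ {x} → x ∈ c → ∃[ i ] fold x₀ next i ≡ x
      position x∈c = toℕ (Any.index x∈c) ,
        trans (sym (proj₁ (sides-orbit next x₀ xs oriented) (Any.index x∈c))) (sym (lookup-index x∈c))

      -- x = nextⁱ x₀ and v = nextʲ x₀ give x = nextⁱ⁺⁹ʲ v.
      reach : ∀ {x} → x ∈ c → Members R decagon v x
      reach x∈c with position x∈c | position v∈c
      ... | i , refl | j , refl = i + j * 9 , (begin
        fold (fold x₀ next j) next (i + j * 9) ≡⟨ fold-+ _ next (i + j * 9) ⟨
        fold x₀ next (i + j * 9 + j) ≡⟨ cong (fold x₀ next) (exponents i j) ⟩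
        fold x₀ next (i + j * 10) ≡⟨ fold-+ x₀ next i ⟩
        fold (fold x₀ next (j * 10)) next i ≡⟨ cong (λ y → fold y next i) (fold-multiple next¹⁰ j x₀) ⟩
        fold x₀ next i ∎)

      to : ∀ {x y} → Side c x y → Adjacent R decagon v x y
      to (inj₁ s) = inj₁ (reach (proj₁ (sides-∈ c s)) , All.lookup oriented s)
      to (inj₂ s) = inj₂ (reach (proj₁ (sides-∈ c s)) , All.lookup oriented s)

      from : ∀ {x y} → Adjacent R decagon v x y → Side c x y
      from (inj₁ (m , refl)) = inj₁ (next-∈ (stay m))
      from (inj₂ (m , refl)) = inj₂ (next-∈ (stay m))

    decode : ∀ k {v c} → Unique c → Code k v c → IsFace R k v c
    decode decagon       _ d = oriented-decagon d
    decode edgeTriangle  u t = record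
      { members = triangle-∈ t ; sides⇔ = triangle-Adjacent u _ (Triangle.size t) (triangle-∈ t) }
    decode orbitTriangle u t = record
      { members = triangle-∈ t ; sides⇔ = triangle-Adjacent u _ (Triangle.size t) (triangle-∈ t) }

-- Deciding the snub property by evaluation

module _ {n : ℕ} where
  open DecMembership (Fin._≟_ {n}) using (_∈?_)
  open DecUnique (Fin._≟_ {n}) using (unique?)

  triangle? : ∀ c x y z → Dec (Triangle c x y z)
  triangle? c x y z =
    map′ (λ (a , b , c) → triangle a b c) (λ (triangle a b c) → a , b , c)
      (All.all? (_∈? c) _ ×-dec unique? _ ×-dec length c ℕ.≟ 3)

  code? : ∀ R k v c → Dec (Code R k v c)
  code? R decagon       v c = v ∈? c ×-dec length c ℕ.≟ 10 ×-dec All.all? (λ _ → _ Fin.≟ _) (sides c)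
  code? R edgeTriangle  v c = triangle? c _ _ _
  code? R orbitTriangle v c = triangle? c _ _ _

module _ (K : Complex) (R : Rotation (Complex.Vertex K)) where
  open Complex K
  open Rotation R
  open DecUnique (Fin._≟_ {vertexCount}) using (unique?)

  Coded : Kind → Vertex → Face → Set
  Coded k v f = Code R k v (face f)

  coded? : ∀ k v f → Dec (Coded k v f)
  coded? k v f = code? R k v (face f)

  anyKind? : {P : Kind → Set} → (∀ k → Dec (P k)) → Dec (∃ P)
  anyKind? P? = map′ (λ { (inj₁ p) → _ , p ; (inj₂ (inj₁ p)) → _ , p ; (inj₂ (inj₂ p)) → _ , p })
                     (λ { (decagon , p) → inj₁ p ; (edgeTriangle , p) → inj₂ (inj₁ p) ; (orbitTriangle , p) → inj₂ (inj₂ p) })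
                     (P? decagon ⊎-dec P? edgeTriangle ⊎-dec P? orbitTriangle)

  allKind? : {P : Kind → Set} → (∀ k → Dec (P k)) → Dec (∀ k → P k)
  allKind? P? = map′ (λ { (p , q , r) decagon → p ; (p , q , r) edgeTriangle → q ; (p , q , r) orbitTriangle → r })
                     (λ p → p _ , p _ , p _)
                     (P? decagon ×-dec P? edgeTriangle ×-dec P? orbitTriangle)

  unique-faces? : Dec (∀ f → Unique (face f))
  unique-faces? = all? λ f → unique? (face f)

  coded⇒? : Dec (∀ f → ∃₂ λ k v → Coded k v f)
  coded⇒? = all? λ f → anyKind? λ k → any? λ v → coded? k v f

  coded⇐? : Dec (∀ k v → ∃ (Coded k v))
  coded⇐? = allKind? λ k → all? λ v → any? λ f → coded? k v f

  -- For a concrete complex and rotation the three `True` arguments reduce to the unit type, so the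
  -- comparison of all faces is carried out by evaluation.
  isSnub : Laws R → True unique-faces? → True coded⇒? → True coded⇐? → IsSnub K R
  isSnub laws unique coded⇒ coded⇐ = record
    { face⇒ = λ f → let k , v , code = toWitness coded⇒ f in k , v , decode R (Laws.next¹⁰ laws) k (toWitness unique f) code
    ; face⇐ = λ k v → let f , code = toWitness coded⇐ k v in f , decode R (Laws.next¹⁰ laws) k (toWitness unique f) code
    }

-- The two triangles listed for a pair i, j are the edge triangles at i and at j, and the remaining
-- ten are the orbits of `ρ`. Labels start at 1 and vertices at 0, hence the shifts.
pairRotation : List (ℕ × ℕ) → Rotation (Fin 30)
pairRotation ps = record
  { next = λ x → (suc (toℕ x) ⁺ ∸ 1) mod 30
  ; σ    = λ x → (swap ps (suc (toℕ x)) ∸ 1) mod 30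
  }

-- Positions relative to a vertex

-- Among the n + 1 values consisting of `y` and the values of `f` two coincide, and by injectivity
-- one of them is `y`. The sizes are related by an equation because a vertex count is only provably
-- equal to 30.
injective⇒surjective : ∀ {m n} {f : Fin m → Fin n} → m ≡ n → (∀ {i j} → f i ≡ f j → i ≡ j) →
                       ∀ y → ∃[ x ] f x ≡ y
injective⇒surjective {f = f} refl injective y with pigeonhole (ℕ.n<1+n _) (λ { zero → y ; (suc i) → f i })
... | zero  , suc j , _     , y≡fj  = j , sym y≡fj
... | suc i , suc j , s≤s i<j , fi≡fj = ⊥-elim (ℕ.<-irrefl (cong toℕ (injective fi≡fj)) i<j)

module _ {A : Set} (R : Rotation A) where
  open Rotation R

  position : A → ℕ → ℕ → A
  position v d i = fold (fold v ρ d) next i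

  -- The position of odd v d k is 2k - 1 modulo 10, so that next takes it to even v d k.
  even odd : A → ℕ → Fin 5 → A
  even v d k = position v d (toℕ k * 2)
  odd  v d k = position v d (9 + toℕ k * 2)

  -- Two maps suffice: by `ρ³` the passage from decagon 2 back to decagon 0 is inverse to `β ∘ α`.
  record Matching (v : A) (α β : Fin 5 → Fin 5) : Set where
    constructor matching
    field
      ρ-even₀ : ∀ k → ρ (even v 0 k) ≡ even v 1 (α k)
      ρ-even₁ : ∀ k → ρ (even v 1 k) ≡ even v 2 (β k)

suc₅ pred₅ : Fin 5 → Fin 5
suc₅ k  = (1 + toℕ k) mod 5
pred₅ k = (4 + toℕ k) mod 5

suc₅-pred₅ : ∀ k → suc₅ (pred₅ k) ≡ k
suc₅-pred₅ = toWitness {a? = all? λ _ → _ Fin.≟ _} _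

-- Both sides index the image under `ρ` of the odd position `k` of decagon 0, which lies on decagon
-- 2. The left side follows `σ` directly; the right side goes back along `ρ` twice, through decagon
-- 1 to decagon 2, and closes up by `ρ³`.
Compatible : (α β : Fin 5 → Fin 5) → Set
Compatible α β = ∀ k → suc₅ (β (α k)) ≡ β (pred₅ (α (pred₅ k)))

module LawsProperties {A : Set} {R : Rotation A} (laws : Laws R) where
  open Rotation R
  open Laws laws

  next-injective : ∀ {x y} → next x ≡ next y → x ≡ y
  next-injective {x} {y} eq = begin
    x                     ≡⟨ next¹⁰ x ⟨
    fold x next 10        ≡⟨ fold-suc next x 9 ⟨
    fold (next x) next 9  ≡⟨ cong (λ z → fold z next 9) eq ⟩
    fold (next y) next 9  ≡⟨ fold-suc next y 9 ⟩
    fold y next 10        ≡⟨ next¹⁰ y ⟩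
    y                     ∎
    where open ≡-Reasoning

  ρ-injective : ∀ {x y} → ρ x ≡ ρ y → x ≡ y
  ρ-injective {x} {y} eq = trans (sym (ρ³ x)) (trans (cong (ρ ∘ ρ) eq) (ρ³ y))

  ρ≡next : ∀ {x y} → ρ x ≡ next y → σ x ≡ y
  ρ≡next = next-injective

  fold-period : ∀ x i → fold x next (10 + i) ≡ fold x next i
  fold-period x i = next¹⁰ (fold x next i)

  fold-% : ∀ x i → fold x next i ≡ fold x next (i % 10)
  fold-% x i = begin
    fold x next i                              ≡⟨ cong (fold x next) (m≡m%n+[m/n]*n i 10) ⟩
    fold x next (i % 10 + i / 10 * 10)         ≡⟨ fold-+ x next (i % 10) ⟩
    fold (fold x next (i / 10 * 10)) next (i % 10)
      ≡⟨ cong (λ y → fold y next (i % 10)) (fold-multiple next¹⁰ (i / 10) x) ⟩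
    fold x next (i % 10)                       ∎
    where open ≡-Reasoning

  -- Cancelling the first `i` steps leaves a return after `j ∸ i` steps, a period from 1 to 9, which
  -- `aperiodic` indexes by its predecessor.
  fold-≢ : ∀ x {i j} → i < j → j < 10 → fold x next i ≢ fold x next j
  fold-≢ x {i} {j} i<j j<10 eq = aperiodic x (fromℕ< k′<9) (trans (cong (fold x next) k≡) (sym (fold-cancel next-injective i back)))
    where
    k = j ∸ i
    suc-pred : suc (ℕ.pred k) ≡ k
    suc-pred = ℕ.suc-pred k ⦃ ℕ.>-nonZero (ℕ.m<n⇒0<n∸m i<j) ⦄
    k′<9 : ℕ.pred k < 9
    k′<9 = ℕ.≤-pred (subst (λ m → suc m ≤ 10) (sym suc-pred) (ℕ.<-≤-trans (s≤s (ℕ.m∸n≤m j i)) j<10))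
    k≡ : suc (toℕ (fromℕ< k′<9)) ≡ k
    k≡ = trans (cong suc (toℕ-fromℕ< k′<9)) suc-pred
    back : fold x next i ≡ fold (fold x next k) next i
    back = trans eq (trans (cong (fold x next) (sym (ℕ.m+[n∸m]≡n (ℕ.<⇒≤ i<j)))) (fold-+ x next i))

  fold-injective : ∀ x {i j} → i < 10 → j < 10 → fold x next i ≡ fold x next j → i ≡ j
  fold-injective x {i} {j} i<10 j<10 eq with ℕ.<-cmp i j
  ... | tri< i<j _ _ = ⊥-elim (fold-≢ x i<j j<10 eq)
  ... | tri≈ _ i≡j _ = i≡j
  ... | tri> _ _ j<i = ⊥-elim (fold-≢ x j<i i<10 (sym eq))

  decagonOf-fold : ∀ x i → decagonOf (fold x next i) ≡ decagonOf x
  decagonOf-fold x zero    = refl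
  decagonOf-fold x (suc i) = trans (decagonOf-next _) (decagonOf-fold x i)

  decagonOf-ρ² : ∀ x → decagonOf (ρ (ρ x)) ≢ decagonOf x
  decagonOf-ρ² x eq = decagonOf-ρ (ρ (ρ x)) (trans (cong decagonOf (ρ³ x)) (sym eq))

  decagonOf-injective : ∀ v (d e : Fin 3) → decagonOf (fold v ρ (toℕ d)) ≡ decagonOf (fold v ρ (toℕ e)) → d ≡ e
  decagonOf-injective v 0F 0F _  = refl
  decagonOf-injective v 0F 1F eq = ⊥-elim (decagonOf-ρ v (sym eq))
  decagonOf-injective v 0F 2F eq = ⊥-elim (decagonOf-ρ² v (sym eq))
  decagonOf-injective v 1F 0F eq = ⊥-elim (decagonOf-ρ v eq)
  decagonOf-injective v 1F 1F _  = refl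
  decagonOf-injective v 1F 2F eq = ⊥-elim (decagonOf-ρ (ρ v) (sym eq))
  decagonOf-injective v 2F 0F eq = ⊥-elim (decagonOf-ρ² v eq)
  decagonOf-injective v 2F 1F eq = ⊥-elim (decagonOf-ρ (ρ v) eq)
  decagonOf-injective v 2F 2F _  = refl

  place : A → Fin 3 × Fin 10 → A
  place v (d , i) = position R v (toℕ d) (toℕ i)

  position-decagon : ∀ v (d e : Fin 3) i j → position R v (toℕ d) i ≡ position R v (toℕ e) j → d ≡ e
  position-decagon v d e i j eq = decagonOf-injective v d e
    (trans (sym (decagonOf-fold _ i)) (trans (cong decagonOf eq) (decagonOf-fold _ j)))

  place-injective : ∀ v p q → place v p ≡ place v q → p ≡ q
  place-injective v (d , i) (e , j) eq with position-decagon v d e (toℕ i) (toℕ j) eq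
  ... | refl = cong (d ,_) (toℕ-injective (fold-injective _ (toℕ<n i) (toℕ<n j) eq))

  even-injective : ∀ v d k l → even R v d k ≡ even R v d l → k ≡ l
  even-injective v d k l eq = toℕ-injective (ℕ.*-cancelʳ-≡ _ _ 2 (fold-injective _ (bound k) (bound l) eq))
    where
    bound : ∀ (k : Fin 5) → toℕ k * 2 < 10
    bound k = ℕ.*-monoˡ-< 2 (toℕ<n k)

  next-odd : ∀ v d k → next (odd R v d k) ≡ even R v d k
  next-odd v d k = fold-period _ (toℕ k * 2)

  next-even : ∀ v d k → next (even R v d k) ≡ odd R v d (suc₅ k)
  next-even v d 0F = sym (fold-period _ 1)
  next-even v d 1F = sym (fold-period _ 3)
  next-even v d 2F = sym (fold-period _ 5)
  next-even v d 3F = sym (fold-period _ 7)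
  -- Here `suc₅` wraps around to 0, and both exponents are 9 without any reduction.
  next-even v d 4F = refl

  parity : ∀ v d (i : Fin 10) → ∃[ k ] (position R v d (toℕ i) ≡ even R v d k ⊎ position R v d (toℕ i) ≡ odd R v d k)
  parity v d 0F = 0F , inj₁ refl
  parity v d 1F = 1F , inj₂ (sym (fold-period _ 1))
  parity v d 2F = 1F , inj₁ refl
  parity v d 3F = 2F , inj₂ (sym (fold-period _ 3))
  parity v d 4F = 2F , inj₁ refl
  parity v d 5F = 3F , inj₂ (sym (fold-period _ 5))
  parity v d 6F = 3F , inj₁ refl
  parity v d 7F = 4F , inj₂ (sym (fold-period _ 7))
  parity v d 8F = 4F , inj₁ refl
  parity v d 9F = 0F , inj₂ refl

  module _ {v α β} (matching : Matching R v α β) where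
    open Matching matching

    σ-even₀ : ∀ k → σ (even R v 0 k) ≡ odd R v 1 (α k)
    σ-even₀ k = ρ≡next (trans (ρ-even₀ k) (sym (next-odd v 1 (α k))))

    σ-even₁ : ∀ k → σ (even R v 1 k) ≡ odd R v 2 (β k)
    σ-even₁ k = ρ≡next (trans (ρ-even₁ k) (sym (next-odd v 2 (β k))))

    -- Two steps of `ρ` lead from position `k` of decagon 0 to this one, so the third returns to
    -- `k`; removing the final `next` gives `σ`.
    σ-even₂ : ∀ k → σ (even R v 2 (β (α k))) ≡ odd R v 0 k
    σ-even₂ k = ρ≡next (begin
      ρ (even R v 2 (β (α k))) ≡⟨ cong ρ (ρ-even₁ (α k)) ⟨
      ρ (ρ (even R v 1 (α k))) ≡⟨ cong (ρ ∘ ρ) (ρ-even₀ k) ⟨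
      ρ (ρ (ρ (even R v 0 k))) ≡⟨ ρ³ _ ⟩
      even R v 0 k             ≡⟨ next-odd v 0 k ⟨
      next (odd R v 0 k)       ∎)
      where open ≡-Reasoning

    α-injective : ∀ {k l} → α k ≡ α l → k ≡ l
    α-injective {k} {l} eq = even-injective v 0 k l (ρ-injective
      (trans (ρ-even₀ k) (trans (cong (even R v 1) eq) (sym (ρ-even₀ l)))))

    β-injective : ∀ {k l} → β k ≡ β l → k ≡ l
    β-injective {k} {l} eq = even-injective v 1 k l (ρ-injective
      (trans (ρ-even₁ k) (trans (cong (even R v 2) eq) (sym (ρ-even₁ l)))))

    -- ρ³ = 1 at the odd positions.
    compatible : Compatible α β
    compatible k = even-injective v 2 (suc₅ (β (α k))) (β j) (begin
      even R v 2 (suc₅ (β (α k)))       ≡⟨ next-odd v 2 (suc₅ (β (α k))) ⟨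
      next (odd R v 2 (suc₅ (β (α k)))) ≡⟨ cong next (next-even v 2 (β (α k))) ⟨
      next (next (even R v 2 (β (α k)))) ≡⟨ cong (next ∘ next) (flip (σ-even₂ k)) ⟨
      next (ρ (odd R v 0 k))            ≡⟨ cong (λ l → next (ρ (odd R v 0 l))) (suc₅-pred₅ k) ⟨
      next (ρ (odd R v 0 (suc₅ m)))     ≡⟨ cong (next ∘ ρ) (next-even v 0 m) ⟨
      next (ρ (next (even R v 0 m)))    ≡⟨ cong (next ∘ ρ ∘ next) (flip (σ-even₀ m)) ⟨
      next (ρ (ρ (odd R v 1 (α m))))    ≡⟨ cong (λ l → next (ρ (ρ (odd R v 1 l)))) (suc₅-pred₅ (α m)) ⟨
      next (ρ (ρ (odd R v 1 (suc₅ j)))) ≡⟨ cong (next ∘ ρ ∘ ρ) (next-even v 1 j) ⟨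
      next (ρ (ρ (next (even R v 1 j)))) ≡⟨ cong (next ∘ ρ ∘ ρ ∘ next) (flip (σ-even₁ j)) ⟨
      next (ρ (ρ (ρ (odd R v 2 (β j))))) ≡⟨ cong next (ρ³ _) ⟩
      next (odd R v 2 (β j))            ≡⟨ next-odd v 2 (β j) ⟩
      even R v 2 (β j)                  ∎)
      where
      open ≡-Reasoning
      m = pred₅ k
      j = pred₅ (α m)
      flip : ∀ {x y} → σ x ≡ y → σ y ≡ x
      flip refl = σ² _

module Thirty {n : ℕ} (n≡30 : n ≡ 30) {R : Rotation (Fin n)} (laws : Laws R) where
  open Rotation R
  open Laws laws
  open LawsProperties laws

  abstract
    -- The 30 places around `v` are distinct, so on 30 vertices they leave none out. Being
    -- `abstract`, the pigeonhole search never unfolds in later goals.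
    locate : ∀ v y → ∃[ p ] place v p ≡ y
    locate v y = Product.map (remQuot 10) id (injective⇒surjective (sym n≡30) injective y)
      where
      injective : ∀ {i j : Fin 30} → place v (remQuot 10 i) ≡ place v (remQuot 10 j) → i ≡ j
      injective {i} {j} eq = trans (sym (combine-remQuot {3} 10 i))
        (trans (cong (λ (d , k) → combine d k) (place-injective v (remQuot 10 i) (remQuot 10 j) eq)) (combine-remQuot {3} 10 j))

  -- Every vertex has a place around `v`, and the labels of `v`, `ρ v` and `ρ (ρ v)` differ; hence
  -- the label of `v` occurs only among the places with `d = 0`.
  same-decagon : ∀ {v x} → decagonOf x ≡ decagonOf v → ∃[ i ] fold v next i ≡ x
  same-decagon {v} {x} eq with locate v x
  ... | (d , i) , refl with decagonOf-injective v d 0F (trans (sym (decagonOf-fold _ (toℕ i))) eq)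
  ... | refl = toℕ i , refl

  three-decagons : ∀ v y → decagonOf y ≢ decagonOf v → decagonOf y ≢ decagonOf (ρ v) →
                   decagonOf y ≡ decagonOf (ρ (ρ v))
  three-decagons v y ≢₀ ≢₁ with locate v y
  ... | (0F , i) , refl = ⊥-elim (≢₀ (decagonOf-fold _ (toℕ i)))
  ... | (1F , i) , refl = ⊥-elim (≢₁ (decagonOf-fold _ (toℕ i)))
  ... | (2F , i) , refl = decagonOf-fold _ (toℕ i)

  -- decagonOf (ρ x) is the decagon across the side from x to next x; these alternate along a decagon.
  across-next : ∀ x → decagonOf (ρ (next x)) ≢ decagonOf (ρ x)
  across-next x eq = decagonOf-ρ (ρ (next x)) (trans (cong decagonOf ρ²-next)
    (trans (sym (decagonOf-next (σ x))) (sym eq)))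
    where
    -- The orbit triangle at `next x` has its third corner at `σ x`, which lies on the decagon
    -- across the side at `x`. The two decagons compared thus belong to two corners of one orbit
    -- triangle.
    ρ²-next : ρ (ρ (next x)) ≡ σ x
    ρ²-next = trans (sym (σ² _)) (cong σ (ρ≡next (ρ³ (next x))))

  -- Both decagons differ from that of `next x` and from the one across the side at `next x`, and
  -- only one decagon is left.
  across-next² : ∀ x → decagonOf (ρ (next (next x))) ≡ decagonOf (ρ x)
  across-next² x = trans
    (three-decagons (next x) (ρ (next (next x)))
      (λ eq → decagonOf-ρ (next (next x)) (trans eq (sym (decagonOf-next (next x)))))
      (across-next (next x)))
    (sym (three-decagons (next x) (ρ x)
      (λ eq → decagonOf-ρ x (trans eq (decagonOf-next x)))
      (λ eq → across-next x (sym eq))))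

  across-even : ∀ x m → decagonOf (ρ (fold x next (m * 2))) ≡ decagonOf (ρ x)
  across-even x zero    = refl
  across-even x (suc m) = trans (across-next² _) (across-even x m)

  -- All even sides of decagon `d` face the decagon of its image base point, so the image lies on
  -- decagon `d + 1`. If its position there were odd, the side at it and the following even side
  -- would both face the third decagon, against `across-next`.
  ρ-even : ∀ v (d : Fin 2) k → ∃[ l ] ρ (even R v (toℕ d) k) ≡ even R v (suc (toℕ d)) l
  ρ-even v d k with locate v (ρ (even R v (toℕ d) k))
  ... | (e , i) , eq with decagonOf-injective v e (suc d)
                            (trans (sym (decagonOf-fold _ (toℕ i)))
                              (trans (cong decagonOf eq) (across-even (fold v ρ (toℕ d)) (toℕ k))))
  ... | refl with parity v (suc (toℕ d)) i
  ... | l , inj₁ p = l , trans (sym eq) p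
  ... | l , inj₂ p = ⊥-elim (across-next (odd R v (suc (toℕ d)) l) (begin
      decagonOf (ρ (next (odd R v (suc (toℕ d)) l))) ≡⟨ cong (decagonOf ∘ ρ) (next-odd v (suc (toℕ d)) l) ⟩
      decagonOf (ρ (even R v (suc (toℕ d)) l))       ≡⟨ across-even (ρ w) (toℕ l) ⟩
      decagonOf (ρ (ρ w))                            ≡⟨ three-decagons w (ρ (ρ x))
                                                          (λ q → decagonOf-ρ² x (trans q (sym (decagonOf-fold w (toℕ k * 2)))))
                                                          (λ q → decagonOf-ρ (ρ x) (trans q (sym (across-even w (toℕ k))))) ⟨
      decagonOf (ρ (ρ x))                            ≡⟨ cong (decagonOf ∘ ρ) (trans (sym eq) p) ⟩
      decagonOf (ρ (odd R v (suc (toℕ d)) l))        ∎))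
    where
    open ≡-Reasoning
    w = fold v ρ (toℕ d)
    x = even R v (toℕ d) k

  -- Both maps fix 0 because the base point of each later decagon is by definition the image under
  -- `ρ` of the preceding base point.
  matched : ∀ v → ∃₂ λ α β → Matching R v α β × α 0F ≡ 0F × β 0F ≡ 0F
  matched v = (λ k → proj₁ (ρ-even v 0F k)) , (λ k → proj₁ (ρ-even v 1F k)) ,
    matching (λ k → proj₂ (ρ-even v 0F k)) (λ k → proj₂ (ρ-even v 1F k)) ,
    even-injective v 1 _ 0F (sym (proj₂ (ρ-even v 0F 0F))) ,
    even-injective v 2 _ 0F (sym (proj₂ (ρ-even v 1F 0F)))

-- Classification of the rotations

module _ (R : Rotation (Fin 30)) where
  open Rotation R

  block : Fin 30 → Fin 3
  block x = proj₁ (remQuot {3} 10 x)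

  laws? : Dec ((∀ x → fold x next 10 ≡ x) × (∀ x → σ (σ x) ≡ x) × (∀ x → ρ (ρ (ρ x)) ≡ x) ×
               (∀ x (i : Fin 9) → fold x next (suc (toℕ i)) ≢ x) ×
               (∀ x → block (next x) ≡ block x) × (∀ x → block (ρ x) ≢ block x))
  laws? = all? (λ _ → _ Fin.≟ _) ×-dec all? (λ _ → _ Fin.≟ _) ×-dec all? (λ _ → _ Fin.≟ _) ×-dec
          all? (λ _ → all? λ _ → ¬? (_ Fin.≟ _)) ×-dec
          all? (λ _ → _ Fin.≟ _) ×-dec all? (λ _ → ¬? (_ Fin.≟ _))

  checkLaws : True laws? → Laws R
  checkLaws ok with toWitness ok
  ... | next¹⁰ , σ² , ρ³ , aperiodic , block-next , block-ρ = record
    { next¹⁰ = next¹⁰ ; σ² = σ² ; ρ³ = ρ³ ; aperiodic = aperiodic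
    ; decagonOf = block ; decagonOf-next = block-next ; decagonOf-ρ = block-ρ }

laws₁ : Laws (pairRotation pairs₁)
laws₁ = checkLaws (pairRotation pairs₁) _

laws₂ : Laws (pairRotation pairs₂)
laws₂ = checkLaws (pairRotation pairs₂) _

isSnub₁ : IsSnub 𝒦₁ (pairRotation pairs₁)
isSnub₁ = isSnub 𝒦₁ (pairRotation pairs₁) laws₁ _ _ _

isSnub₂ : IsSnub 𝒦₂ (pairRotation pairs₂)
isSnub₂ = isSnub 𝒦₂ (pairRotation pairs₂) laws₂ _ _ _

-- Lets statements about all functions between finite sets be decided by running through their
-- tables of values.
allVec? : ∀ {m n} {P : Vec (Fin m) n → Set} → (∀ v → Dec (P v)) → Dec (∀ v → P v)
allVec? {n = zero}  P? = map′ (λ { p [] → p }) (λ p → p []) (P? [])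
allVec? {n = suc n} P? =
  map′ (λ { p (x ∷ v) → p x v }) (λ p x v → p (x ∷ v)) (all? λ x → allVec? λ v → P? (x ∷ v))

-- A function fixing 0 has four free values, which gives 625 tables, 24 of them injective.
fix0 : Vec (Fin 5) 4 → Fin 5 → Fin 5
fix0 u = Vec.lookup (0F ∷ u)

Matches : List (ℕ × ℕ) → (α β : Fin 5 → Fin 5) → Set
Matches ps α β = ∃[ x ] Matching (pairRotation ps) x α β

matches? : ∀ ps α β → Dec (Matches ps α β)
matches? ps α β = any? λ x →
  map′ (λ (p , q) → matching p q) (λ (matching p q) → p , q)
    (all? (λ _ → _ Fin.≟ _) ×-dec all? (λ _ → _ Fin.≟ _))

injective? : ∀ {m n} (f : Fin m → Fin n) → Dec (∀ i j → f i ≡ f j → i ≡ j)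
injective? f = all? λ i → all? λ j → (f i Fin.≟ f j) →-dec (i Fin.≟ j)

compatible? : ∀ α β → Dec (Compatible α β)
compatible? α β = all? λ k → suc₅ (β (α k)) Fin.≟ β (pred₅ (α (pred₅ k)))

Classified : (α β : Fin 5 → Fin 5) → Set
Classified α β = Matches pairs₁ α β ⊎ Matches pairs₂ α β

-- Only α has to be injective: compatibility then determines β.
classify? : Dec (∀ u → (∀ i j → fix0 u i ≡ fix0 u j → i ≡ j) →
                 ∀ w → Compatible (fix0 u) (fix0 w) → Classified (fix0 u) (fix0 w))
classify? = allVec? λ u → injective? (fix0 u) →-dec allVec? λ w → compatible? (fix0 u) (fix0 w) →-dec
            (matches? pairs₁ (fix0 u) (fix0 w) ⊎-dec matches? pairs₂ (fix0 u) (fix0 w))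

fix0-tabulate : ∀ f → f 0F ≡ 0F → f ≗ fix0 (Vec.tabulate (f ∘ suc))
fix0-tabulate f f0 zero    = f0
fix0-tabulate f f0 (suc k) = sym (lookup∘tabulate (f ∘ suc) k)

-- The search speaks of tables, so `α` and `β` are tabulated first, and the matching found is
-- carried back along pointwise equality.
classify : ∀ {α β} → α 0F ≡ 0F → β 0F ≡ 0F → (∀ {i j} → α i ≡ α j → i ≡ j) → Compatible α β → Classified α β
classify {α} {β} α0 β0 α-injective compatible =
  Sum.map (transport pairs₁) (transport pairs₂) (toWitness {a? = classify?} _ u
    (λ i j eq → α-injective (trans (α≗ i) (trans eq (sym (α≗ j)))))
    w
    λ k → trans (cong suc₅ (sym (trans (cong β (α≗ k)) (β≗ _))))
            (trans (compatible k) (trans (cong (β ∘ pred₅) (α≗ (pred₅ k))) (β≗ _))))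
  where
  u = Vec.tabulate (α ∘ suc)
  w = Vec.tabulate (β ∘ suc)
  α≗ = fix0-tabulate α α0
  β≗ = fix0-tabulate β β0
  transport : ∀ ps → Matches ps (fix0 u) (fix0 w) → Matches ps α β
  transport ps (x , matching m m′) = x , matching
    (λ k → trans (m k) (cong (even (pairRotation ps) x 1) (sym (α≗ k))))
    (λ k → trans (m′ k) (cong (even (pairRotation ps) x 2) (sym (β≗ k))))

-- Isomorphism of maps with equal matchings

record Equivariant {A B : Set} (R : Rotation A) (R′ : Rotation B) (φ : A → B) : Set where
  private
    module R  = Rotation R
    module R′ = Rotation R′
  field
    φ-next : ∀ x → φ (R.next x) ≡ R′.next (φ x)
    φ-σ    : ∀ x → φ (R.σ x) ≡ R′.σ (φ x)

  φ-ρ : ∀ x → φ (R.ρ x) ≡ R′.ρ (φ x)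
  φ-ρ x = trans (φ-next _) (cong R′.next (φ-σ x))

  φ-fold : ∀ x i → φ (fold x R.next i) ≡ fold (φ x) R′.next i
  φ-fold x zero    = refl
  φ-fold x (suc i) = trans (φ-next _) (cong R′.next (φ-fold x i))

module _ {n} (n≡30 : n ≡ 30) {R : Rotation (Fin n)} (laws : Laws R)
         {R′ : Rotation (Fin 30)} (laws′ : Laws R′)
         {v v′ α β} (m : Matching R v α β) (m′ : Matching R′ v′ α β) where
  private
    module R  = Rotation R
    module R′ = Rotation R′
    module L  = LawsProperties laws
    module L′ = LawsProperties laws′
  open Thirty n≡30 laws using (locate)

  relabel : Fin n → Fin 30
  relabel y = L′.place v′ (proj₁ (locate v y))

  relabel-injective : ∀ {x y} → relabel x ≡ relabel y → x ≡ y
  relabel-injective {x} {y} eq = trans (sym (proj₂ (locate v x)))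
    (trans (cong (L.place v) (L′.place-injective v′ (proj₁ (locate v x)) (proj₁ (locate v y)) eq)) (proj₂ (locate v y)))

  -- The exponent must be arbitrary: `next` leads from 9 to 10, and odd positions have exponents up
  -- to 17. Both sides have period 10, so `i` may be reduced to a place.
  relabel-position : ∀ (d : Fin 3) i → relabel (position R v (toℕ d) i) ≡ position R′ v′ (toℕ d) i
  relabel-position d i = begin
    relabel (position R v (toℕ d) i) ≡⟨ cong relabel (trans (L.fold-% _ i) (cong (position R v (toℕ d)) (sym i%10))) ⟩
    relabel (L.place v (d , j))      ≡⟨ cong (L′.place v′) (L.place-injective v (proj₁ located) (d , j) (proj₂ located)) ⟩
    L′.place v′ (d , j)              ≡⟨ trans (cong (position R′ v′ (toℕ d)) i%10) (sym (L′.fold-% _ i)) ⟩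
    position R′ v′ (toℕ d) i         ∎
    where
    open ≡-Reasoning
    j : Fin 10
    j = fromℕ< (m%n<n i 10)
    located = locate v (L.place v (d , j))
    i%10 : toℕ j ≡ i % 10
    i%10 = toℕ-fromℕ< (m%n<n i 10)

  relabel-next : ∀ y → relabel (R.next y) ≡ R′.next (relabel y)
  relabel-next y with locate v y
  ... | (d , i) , refl = relabel-position d (suc (toℕ i))

  Commutes : Fin n → Set
  Commutes x = relabel (R.σ x) ≡ R′.σ (relabel x)

  commutes : ∀ (d e : Fin 3) k l → R.σ (even R v (toℕ d) k) ≡ odd R v (toℕ e) l →
             R′.σ (even R′ v′ (toℕ d) k) ≡ odd R′ v′ (toℕ e) l → Commutes (even R v (toℕ d) k)
  commutes d e k l eq eq′ = trans (cong relabel eq) (trans (relabel-position e (9 + toℕ l * 2))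
    (sym (trans (cong R′.σ (relabel-position d (toℕ k * 2))) eq′)))

  -- `σ` is an involution on both sides, so commutation passes from a vertex to its partner. Every
  -- odd position is the partner of an even one.
  commutes-σ : ∀ {x y} → R.σ x ≡ y → Commutes x → Commutes y
  commutes-σ {x} refl c = begin
    relabel (R.σ (R.σ x))       ≡⟨ cong relabel (Laws.σ² laws x) ⟩
    relabel x                   ≡⟨ Laws.σ² laws′ (relabel x) ⟨
    R′.σ (R′.σ (relabel x))     ≡⟨ cong R′.σ c ⟨
    R′.σ (relabel (R.σ x))      ∎
    where open ≡-Reasoning

  α-onto : ∀ k → ∃[ l ] α l ≡ k
  α-onto = injective⇒surjective refl (L.α-injective m)

  β-onto : ∀ k → ∃[ l ] β l ≡ k
  β-onto = injective⇒surjective refl (L.β-injective m)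

  even-commutes : ∀ (d : Fin 3) k → Commutes (even R v (toℕ d) k)
  even-commutes 0F k = commutes 0F 1F k (α k) (L.σ-even₀ m k) (L′.σ-even₀ m′ k)
  even-commutes 1F k = commutes 1F 2F k (β k) (L.σ-even₁ m k) (L′.σ-even₁ m′ k)
  -- On decagon 2 the values of `σ` are known at the indices `β (α j)`; surjectivity of both maps
  -- writes every `k` in this way.
  even-commutes 2F k with β-onto k
  ... | l , refl with α-onto l
  ... | j , refl = commutes 2F 0F (β (α j)) j (L.σ-even₂ m j) (L′.σ-even₂ m′ j)

  odd-commutes : ∀ (d : Fin 3) k → Commutes (odd R v (toℕ d) k)
  odd-commutes 0F k = commutes-σ (L.σ-even₂ m k) (even-commutes 2F (β (α k)))
  odd-commutes 1F k with α-onto k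
  ... | l , refl = commutes-σ (L.σ-even₀ m l) (even-commutes 0F l)
  odd-commutes 2F k with β-onto k
  ... | l , refl = commutes-σ (L.σ-even₁ m l) (even-commutes 1F l)

  relabel-σ : ∀ y → Commutes y
  relabel-σ y = subst Commutes (proj₂ (locate v y)) (commutes-place (proj₁ (locate v y)))
    where
    commutes-place : ∀ p → Commutes (L.place v p)
    commutes-place (d , i) with L.parity v (toℕ d) i
    ... | k , inj₁ p = subst Commutes (sym p) (even-commutes d k)
    ... | k , inj₂ p = subst Commutes (sym p) (odd-commutes d k)

  relabel-equivariant : Equivariant R R′ relabel
  relabel-equivariant = record { φ-next = relabel-next ; φ-σ = relabel-σ }

module _ {A B : Set} {R : Rotation A} {R′ : Rotation B} {φ : A → B}
         (injective : ∀ {x y} → φ x ≡ φ y → x ≡ y) (equivariant : Equivariant R R′ φ) where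
  private
    module R  = Rotation R
    module R′ = Rotation R′
  open Equivariant equivariant
  open Equivalence

  ∈-transport : ∀ {l l′ x} → map φ l ≡ l′ → x ∈ l ⇔ φ x ∈ l′
  ∈-transport refl = mk⇔ (∈-map⁺ φ) λ p → let _ , q , eq = ∈-map⁻ φ p in subst (_∈ _) (sym (injective eq)) q

  Members-transport : ∀ k v x → Members R k v x ⇔ Members R′ k (φ v) (φ x)
  Members-transport decagon v x = mk⇔
    (λ { (i , refl) → i , sym (φ-fold v i) })
    (λ (i , eq) → i , injective (trans (φ-fold v i) eq))
  Members-transport edgeTriangle v x =
    ∈-transport (cong₂ (λ a b → φ v ∷ a ∷ b ∷ []) (φ-next v) (φ-σ v))
  Members-transport orbitTriangle v x =
    ∈-transport (cong₂ (λ a b → φ v ∷ a ∷ b ∷ []) (φ-ρ v) (trans (φ-ρ _) (cong R′.ρ (φ-ρ v))))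

  next-transport : ∀ x y → R.next x ≡ y ⇔ R′.next (φ x) ≡ φ y
  next-transport x y = mk⇔ (λ { refl → sym (φ-next x) }) (λ eq → injective (trans (φ-next x) eq))

  triple-transport : ∀ k v x y → (Members R k v x × Members R k v y × x ≢ y) ⇔
                                 (Members R′ k (φ v) (φ x) × Members R′ k (φ v) (φ y) × φ x ≢ φ y)
  triple-transport k v x y = mk⇔
    (λ (p , q , x≢y) → to (Members-transport k v x) p , to (Members-transport k v y) q , x≢y ∘ injective)
    (λ (p , q , φx≢φy) → from (Members-transport k v x) p , from (Members-transport k v y) q , φx≢φy ∘ cong φ)

  Adjacent-transport : ∀ k v x y → Adjacent R k v x y ⇔ Adjacent R′ k (φ v) (φ x) (φ y)
  Adjacent-transport decagon v x y = mk⇔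
    (Sum.map (Product.map (to (m x)) (to (n x y))) (Product.map (to (m y)) (to (n y x))))
    (Sum.map (Product.map (from (m x)) (from (n x y))) (Product.map (from (m y)) (from (n y x))))
    where
    m = Members-transport decagon v
    n = next-transport
  Adjacent-transport edgeTriangle  = triple-transport edgeTriangle
  Adjacent-transport orbitTriangle = triple-transport orbitTriangle

  carries : ∀ {k v c d} → IsFace R k v c → IsFace R′ k (φ v) d → Carries φ c d
  carries {k} {v} F F′ =
    (λ x → ⇔-trans (IsFace.members F x) (⇔-trans (Members-transport k v x) (⇔-sym (IsFace.members F′ (φ x))))) ,
    (λ x y → ⇔-trans (IsFace.sides⇔ F x y) (⇔-trans (Adjacent-transport k v x y) (⇔-sym (IsFace.sides⇔ F′ (φ x) (φ y)))))

module _ {K L : Complex} {R : Rotation (Complex.Vertex K)} {R′ : Rotation (Complex.Vertex L)}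
         (snub : IsSnub K R) (snub′ : IsSnub L R′)
         {φ : Complex.Vertex K → Complex.Vertex L} (injective : ∀ {x y} → φ x ≡ φ y → x ≡ y)
         (surjective : ∀ y → ∃[ x ] φ x ≡ y) (equivariant : Equivariant R R′ φ) where
  private
    module K = Complex K
    module L = Complex L
  open Equivalence

  faces⇒ : ∀ f → ∃[ g ] Carries φ (K.face f) (L.face g)
  faces⇒ f with IsSnub.face⇒ snub f
  ... | k , v , F with IsSnub.face⇐ snub′ k (φ v)
  ... | g , F′ = g , carries injective equivariant F F′

  faces⇐ : ∀ g → ∃[ f ] Carries φ (K.face f) (L.face g)
  faces⇐ g with IsSnub.face⇒ snub′ g
  ... | k , w , F′ with surjective w
  ... | v , refl with IsSnub.face⇐ snub k v
  ... | f , F = f , carries injective equivariant F F′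

  snub-≅ : K ≅ L
  snub-≅ = record
    { bijection = mk↔ₛ′ φ (proj₁ ∘ surjective) (proj₂ ∘ surjective) (λ x → injective (proj₂ (surjective (φ x))))
    ; edges⇔ = λ x y → mk⇔
        (λ (f , s) → let g , _ , sides = faces⇒ f in g , to (sides x y) s)
        (λ (g , s) → let f , _ , sides = faces⇐ g in f , from (sides x y) s)
    ; faces⇒ = faces⇒
    ; faces⇐ = faces⇐
    }

-- An arbitrary base vertex `v` yields `α` and `β`, the search yields a vertex `x` of a model with
-- the same two maps, and sending positions around `v` to positions around `x` is the isomorphism.
snub-classification : (K : Complex) → let open Complex K in {R : Rotation Vertex} →
  vertexCount ≡ 30 → Vertex → Laws R → IsSnub K R → K ≅ 𝒦₁ ⊎ K ≅ 𝒦₂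
snub-classification K {R} n≡30 v laws snub with Thirty.matched n≡30 laws v
... | α , β , m , α0 , β0 = Sum.map (iso pairs₁ laws₁ isSnub₁) (iso pairs₂ laws₂ isSnub₂)
  (classify {α} {β} α0 β0 (LawsProperties.α-injective laws m) (LawsProperties.compatible laws m))
  where
  iso : ∀ ps → Laws (pairRotation ps) → IsSnub (𝒦 ps) (pairRotation ps) → Matches ps α β → K ≅ 𝒦 ps
  iso ps laws′ snub′ (x , m′) = snub-≅ snub snub′ injective (injective⇒surjective n≡30 injective)
    (relabel-equivariant n≡30 laws laws′ m m′)
    where injective = relabel-injective n≡30 laws laws′ m m′

-- The local structure

-- Adjacency along the path 0, 1, 2, 3, 4. The ends are not joined, since the decagon lies between
-- them.
near : Fin 5 → List (Fin 5)
near 0F = 1F ∷ []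
near 1F = 0F ∷ 2F ∷ []
near 2F = 1F ∷ 3F ∷ []
near 3F = 2F ∷ 4F ∷ []
near 4F = 3F ∷ []

-- The neighbours of v in cyclic order, starting and ending on the decagon of v.
record Fan {V : Set} (Triple : V → V → V → Set) (Rim : V → V → Set) (v : V) : Set where
  field
    w           : Fin 5 → V
    w-injective : ∀ {i j} → w i ≡ w j → i ≡ j
    end₀        : Rim v (w 0F)
    end₄        : Rim v (w 4F)
    ends        : ∀ {x} → Rim v x → x ≡ w 0F ⊎ x ≡ w 4F
    spoke       : ∀ i → Triple v (w (inject₁ i)) (w (suc i))
    only        : ∀ {x y} → Triple v x y → ∃₂ λ i j → j ∈ near i × x ≡ w i × y ≡ w j

-- Triple x y z says that x, y and z span a triangle, and step goes along each decagon in the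
-- direction in which the decagon happens to be listed.
record Net (n : ℕ) : Set₁ where
  field
    Triple          : Fin n → Fin n → Fin n → Set
    step            : Fin n → Fin n
    {Decagon}       : Set
    decagonAt       : Fin n → Decagon

  Rim : Fin n → Fin n → Set
  Rim x y = step x ≡ y ⊎ step y ≡ x

  field
    rotate          : ∀ {x y z} → Triple x y z → Triple y z x
    exchange        : ∀ {x y z} → Triple x y z → Triple x z y
    distinct        : ∀ {x y z} → Triple x y z → x ≢ y
    step-injective  : ∀ {x y} → step x ≡ step y → x ≡ y
    step¹⁰          : ∀ x → fold x step 10 ≡ x
    step-aperiodic  : ∀ x (i : Fin 9) → fold x step (suc (toℕ i)) ≢ x
    step-decagon    : ∀ x → decagonAt (step x) ≡ decagonAt x
    meets           : ∀ {x y z} → Triple x y z → decagonAt x ≡ decagonAt y → Rim x y × decagonAt z ≢ decagonAt x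
    fan₀            : ∀ v → Fan Triple Rim v

module NetProperties {n : ℕ} (net : Net n) where
  open Net net
  open Fan

  V : Set
  V = Fin n

  Star : V → Set
  Star = Fan Triple Rim

  flip : ∀ {v} → Star v → Star v
  flip F = record
    { w = w F ∘ opposite
    ; w-injective = λ {i} {j} eq → trans (sym (opposite-involutive i))
                      (trans (cong opposite (w-injective F eq)) (opposite-involutive j))
    ; end₀ = end₄ F
    ; end₄ = end₀ F
    ; ends = Sum.swap ∘ ends F
    ; spoke = λ { 0F → exchange (spoke F 3F) ; 1F → exchange (spoke F 2F)
                ; 2F → exchange (spoke F 1F) ; 3F → exchange (spoke F 0F) }
    ; only = λ t → let i , j , j∈ , x≡ , y≡ = only F t in
        opposite i , opposite j , near-opposite i j∈ ,
        trans x≡ (cong (w F) (sym (opposite-involutive i))) ,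
        trans y≡ (cong (w F) (sym (opposite-involutive j)))
    }
    where
    near-opposite : ∀ i {j} → j ∈ near i → opposite j ∈ near (opposite i)
    near-opposite 0F (here refl)         = here refl
    near-opposite 1F (here refl)         = there (here refl)
    near-opposite 1F (there (here refl)) = here refl
    near-opposite 2F (here refl)         = there (here refl)
    near-opposite 2F (there (here refl)) = here refl
    near-opposite 3F (here refl)         = there (here refl)
    near-opposite 3F (there (here refl)) = here refl
    near-opposite 4F (here refl)         = here refl

  Rim-sym : ∀ {x y} → Rim x y → Rim y x
  Rim-sym = Sum.swap

  Rim-decagon : ∀ {x y} → Rim x y → decagonAt x ≡ decagonAt y
  Rim-decagon (inj₁ refl) = sym (step-decagon _)
  Rim-decagon (inj₂ refl) = step-decagon _

  Rim-step : ∀ x → Rim x (step x)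
  Rim-step x = inj₁ refl

  reverse : ∀ {x y z} → Triple x y z → Triple y x z
  reverse t = exchange (rotate t)

  beside : ∀ {v} (F : Star v) {i y} → Triple v (w F i) y → ∃[ j ] (j ∈ near i × y ≡ w F j)
  beside F t with only F t
  ... | i′ , j , j∈ , x≡ , y≡ with w-injective F x≡
  ... | refl = j , j∈ , y≡

  apex : ∀ {x y} → Rim x y → ∃[ z ] Triple x y z
  apex {x} r with ends (fan₀ x) r
  ... | inj₁ refl = _ , spoke (fan₀ x) 0F
  ... | inj₂ refl = _ , exchange (spoke (fan₀ x) 3F)

  -- A rim neighbour is an end of the fan, where `near` has a single entry.
  apex-unique : ∀ {x y z z′} → Rim x y → Triple x y z → Triple x y z′ → z ≡ z′
  apex-unique {x} r t t′ with ends (fan₀ x) r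
  apex-unique {x} r t t′ | inj₁ refl with beside (fan₀ x) t | beside (fan₀ x) t′
  ... | _ , here refl , refl | _ , here refl , refl = refl
  apex-unique {x} r t t′ | inj₂ refl with beside (fan₀ x) t | beside (fan₀ x) t′
  ... | _ , here refl , refl | _ , here refl , refl = refl

  -- Two rim triangles opposite v that share the edge from v to w₂ would close up around w₂.
  not-both : ∀ {v} (F : Star v) → Rim (w F 1F) (w F 2F) → ¬ Rim (w F 2F) (w F 3F)
  not-both {v} F r r′ = clash (ends G (Rim-sym r)) (ends G r′)
    where
    G : Star (w F 2F)
    G = fan₀ (w F 2F)

    t : Triple (w F 2F) (w F 1F) v
    t = exchange (rotate (rotate (spoke F 1F)))

    t′ : Triple (w F 2F) (w F 3F) v
    t′ = rotate (spoke F 2F)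

    spokes : ∀ {a b} → Triple (w F 2F) a v → Triple (w F 2F) b v → a ≡ w G 0F → b ≡ w G 4F → ⊥
    spokes t t′ refl refl with beside G t | beside G t′
    ... | _ , here refl , eq | _ , here refl , eq′ with w-injective G (trans (sym eq) eq′)
    ... | ()

    same : w F 1F ≢ w F 3F
    same eq with w-injective F eq
    ... | ()

    clash : w F 1F ≡ w G 0F ⊎ w F 1F ≡ w G 4F → w F 3F ≡ w G 0F ⊎ w F 3F ≡ w G 4F → ⊥
    clash (inj₁ p) (inj₁ q) = same (trans p (sym q))
    clash (inj₁ p) (inj₂ q) = spokes t t′ p q
    clash (inj₂ p) (inj₁ q) = spokes t′ t q p
    clash (inj₂ p) (inj₂ q) = same (trans p (sym q))

  SamePair : V → V → V → V → Set
  SamePair x y a b = (x ≡ a × y ≡ b) ⊎ (x ≡ b × y ≡ a)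

  SamePair-euclidean : ∀ {x y x′ y′ a b} → SamePair x y a b → SamePair x′ y′ a b → SamePair x y x′ y′
  SamePair-euclidean (inj₁ (refl , refl)) (inj₁ (refl , refl)) = inj₁ (refl , refl)
  SamePair-euclidean (inj₁ (refl , refl)) (inj₂ (refl , refl)) = inj₂ (refl , refl)
  SamePair-euclidean (inj₂ (refl , refl)) (inj₁ (refl , refl)) = inj₂ (refl , refl)
  SamePair-euclidean (inj₂ (refl , refl)) (inj₂ (refl , refl)) = inj₁ (refl , refl)

  -- Each of the two outer triangles already has a rim side at `v`. With the side opposite `v` on
  -- the rim too, its three corners would lie on one decagon, which `meets` forbids.
  base : ∀ {v} (F : Star v) {x y} → Triple v x y → Rim x y →
         (Rim (w F 1F) (w F 2F) × SamePair x y (w F 1F) (w F 2F)) ⊎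
         (Rim (w F 2F) (w F 3F) × SamePair x y (w F 2F) (w F 3F))
  base {v} F t r with only F t
  ... | 0F , 1F , here refl , refl , refl = ⊥-elim (proj₂ (meets (rotate t) (Rim-decagon r)) (Rim-decagon (end₀ F)))
  ... | 1F , 0F , here refl , refl , refl = ⊥-elim (proj₂ (meets (rotate (exchange t)) (Rim-decagon (Rim-sym r))) (Rim-decagon (end₀ F)))
  ... | 1F , 0F , there (here ()) , _
  ... | 1F , 2F , there (here refl) , refl , refl = inj₁ (r , inj₁ (refl , refl))
  ... | 2F , 1F , here refl , refl , refl = inj₁ (Rim-sym r , inj₂ (refl , refl))
  ... | 2F , 1F , there (here ()) , _
  ... | 2F , 3F , there (here refl) , refl , refl = inj₂ (r , inj₁ (refl , refl))
  ... | 3F , 2F , here refl , refl , refl = inj₂ (Rim-sym r , inj₂ (refl , refl))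
  ... | 3F , 2F , there (here ()) , _
  ... | 3F , 4F , there (here refl) , refl , refl = ⊥-elim (proj₂ (meets (rotate (exchange t)) (Rim-decagon (Rim-sym r))) (Rim-decagon (end₄ F)))
  ... | 4F , 3F , here refl , refl , refl = ⊥-elim (proj₂ (meets (rotate t) (Rim-decagon r)) (Rim-decagon (end₄ F)))

  base-unique : ∀ {v x y x′ y′} → Triple v x y → Rim x y → Triple v x′ y′ → Rim x′ y′ → SamePair x y x′ y′
  base-unique {v} t r t′ r′ with base (fan₀ v) t r | base (fan₀ v) t′ r′
  ... | inj₁ (_ , s) | inj₁ (_ , s′) = SamePair-euclidean s s′
  ... | inj₁ (m , _) | inj₂ (m′ , _) = ⊥-elim (not-both (fan₀ v) m m′)
  ... | inj₂ (m , _) | inj₁ (m′ , _) = ⊥-elim (not-both (fan₀ v) m′ m)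
  ... | inj₂ (_ , s) | inj₂ (_ , s′) = SamePair-euclidean s s′

  -- There are as many sides as vertices, so by injectivity every vertex is the apex over a side.
  apexOf : V → V
  apexOf v = proj₁ (apex (Rim-step v))

  apexOf-Triple : ∀ v → Triple (apexOf v) v (step v)
  apexOf-Triple v = rotate (rotate (proj₂ (apex (Rim-step v))))

  apexOf-injective : ∀ {v v′} → apexOf v ≡ apexOf v′ → v ≡ v′
  apexOf-injective {v} {v′} eq
    with base-unique (apexOf-Triple v) (Rim-step v)
                     (subst (λ z → Triple z v′ (step v′)) (sym eq) (apexOf-Triple v′)) (Rim-step v′)
  ... | inj₁ (v≡v′ , _) = v≡v′
  -- The same side read in the opposite direction would give `step` the period 2, excluded by the
  -- index 1.
  ... | inj₂ (v≡ , sv≡v′) = ⊥-elim (step-aperiodic v′ 1F (trans (cong step (sym v≡)) sv≡v′))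

  abstract
    base-exists : ∀ v → ∃[ u ] (Triple v u (step u))
    base-exists v with injective⇒surjective refl apexOf-injective v
    ... | u , refl = u , apexOf-Triple u

  -- Coherent orientation of the fans

  record OrientedStar (v : V) : Set where
    field
      fan    : Star v
      middle : Rim (w fan 1F) (w fan 2F)

  -- The side over which `v` is the apex has the indices 1, 2 or 2, 3; in the second case reading
  -- the fan backwards moves it to 1, 2. This removes the freedom of direction and determines
  -- `next v` and `σ v`.
  oriented : ∀ v → OrientedStar v
  oriented v with base (fan₀ v) (proj₂ (base-exists v)) (Rim-step (proj₁ (base-exists v)))
  ... | inj₁ (r , _) = record { fan = fan₀ v ; middle = r }
  ... | inj₂ (r , _) = record { fan = flip (fan₀ v) ; middle = Rim-sym r }

  abstract
    fan : ∀ v → Star v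
    fan v = OrientedStar.fan (oriented v)

    middle : ∀ v → Rim (w (fan v) 1F) (w (fan v) 2F)
    middle v = OrientedStar.middle (oriented v)

  rotation : Rotation V
  rotation = record { next = λ v → w (fan v) 0F ; σ = λ v → w (fan v) 1F }

  open Rotation rotation

  w-≢ : ∀ v {i j} → i ≢ j → w (fan v) i ≢ w (fan v) j
  w-≢ v i≢j eq = i≢j (w-injective (fan v) eq)

  Rim-next : ∀ v → Rim v (next v)
  Rim-next v = end₀ (fan v)

  -- Seen from `σ v`, the opposite rim side is that of `v` and `next v`, so `v` has index 1 or 2 in
  -- the fan there. The neighbour `w 2` of `v` is an end of that fan and lies next to `v`; as the
  -- last end it would force index 3 on `v`, so it is the first one, and `v` has index 1.
  reflect : ∀ v → σ (σ v) ≡ v × next (σ v) ≡ w (fan v) 2F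
  reflect v = go (ends G (middle v)) (base-unique rimTriple (Rim-next v) (spoke G 1F) (middle (σ v)))
    where
    G = fan (σ v)

    rimTriple : Triple (σ v) v (next v)
    rimTriple = rotate (rotate (spoke (fan v) 0F))

    t : Triple (σ v) (w (fan v) 2F) v
    t = rotate (spoke (fan v) 1F)

    opposite-end : ∀ {x} → x ≡ w G 4F → Triple (σ v) x v → v ≡ w G 3F
    opposite-end refl t with beside G t
    ... | _ , here refl , eq = eq

    near-end : ∀ {x} → x ≡ w G 0F → Triple (σ v) x v → v ≡ w G 1F
    near-end refl t with beside G t
    ... | _ , here refl , eq = eq

    go : w (fan v) 2F ≡ w G 0F ⊎ w (fan v) 2F ≡ w G 4F → SamePair v (next v) (w G 1F) (w G 2F) →
         σ (σ v) ≡ v × next (σ v) ≡ w (fan v) 2F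
    go (inj₁ p) _              = sym (near-end p t) , sym p
    go (inj₂ p) (inj₁ (q , _)) = ⊥-elim (w-≢ (σ v) (λ ()) (trans (sym (opposite-end p t)) q))
    go (inj₂ p) (inj₂ (q , _)) = ⊥-elim (w-≢ (σ v) (λ ()) (trans (sym (opposite-end p t)) q))

  σ² : ∀ v → σ (σ v) ≡ v
  σ² v = proj₁ (reflect v)

  ρ≡w₂ : ∀ v → ρ v ≡ w (fan v) 2F
  ρ≡w₂ v = proj₂ (reflect v)

  -- Selections at adjacent vertices never point at each other: the side of `v` and `next v` would
  -- have both `σ v` and `σ (next v)` as its only apex, and cancelling `σ` gives `v = next v`.
  next²-≢ : ∀ v → next (next v) ≢ v
  next²-≢ v eq = distinct (spoke (fan v) 0F) (trans (sym (σ² v)) (trans (cong σ σ≡) (σ² (next v))))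
    where
    σ≡ : σ v ≡ σ (next v)
    σ≡ = apex-unique (Rim-next v) (spoke (fan v) 0F)
           (reverse (subst (λ z → Triple (next v) z (σ (next v))) eq (spoke (fan (next v)) 0F)))

  next-w₄ : ∀ {u v} → next u ≡ v → u ≡ w (fan v) 4F
  next-w₄ {u} refl with ends (fan (next u)) (Rim-sym (Rim-next u))
  ... | inj₁ eq = ⊥-elim (next²-≢ u (sym eq))
  ... | inj₂ eq = eq

  abstract
    previous : ∀ v → ∃[ u ] next u ≡ v
    previous = injective⇒surjective refl λ eq → trans (next-w₄ eq) (sym (next-w₄ refl))

  -- Both are the apex of the side of `u` and `v`, seen from its two ends.
  σ-w₃ : ∀ {u v} → next u ≡ v → σ u ≡ w (fan v) 3F
  σ-w₃ {u} refl = apex-unique (Rim-sym (Rim-next u)) (reverse (spoke (fan u) 0F))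
    (subst (λ z → Triple (next u) z (w (fan (next u)) 3F)) (sym (next-w₄ refl)) (exchange (spoke (fan (next u)) 3F)))

  -- In the fan of `ρ v` the vertex `v` has index 3, so `w 3` of `v`, which spans a triangle with
  -- both, has index 2 or 4 there. Index 2 is `ρ (ρ v)`; index 4 is `σ v`, which is `w 1` of `v` and
  -- cannot equal `w 3`.
  ρ²≡w₃ : ∀ v → ρ (ρ v) ≡ w (fan v) 3F
  ρ²≡w₃ v with beside (fan (ρ v)) (subst (λ z → Triple (ρ v) z (w (fan v) 3F)) v≡ t)
    where
    v≡ : v ≡ w (fan (ρ v)) 3F
    v≡ = trans (sym (σ² v)) (σ-w₃ refl)
    t : Triple (ρ v) v (w (fan v) 3F)
    t = subst (λ z → Triple z v (w (fan v) 3F)) (sym (ρ≡w₂ v)) (reverse (spoke (fan v) 2F))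
  ... | _ , here refl , eq         = trans (ρ≡w₂ (ρ v)) (sym eq)
  ... | _ , there (here refl) , eq = ⊥-elim (w-≢ v (λ ()) (trans eq (sym (next-w₄ {u = σ v} refl))))

  ρ³ : ∀ v → ρ (ρ (ρ v)) ≡ v
  ρ³ v with previous v
  ... | u , next-u≡v = begin
    ρ (ρ (ρ v))         ≡⟨ cong ρ (ρ²≡w₃ v) ⟩
    ρ (w (fan v) 3F)    ≡⟨ cong ρ (σ-w₃ next-u≡v) ⟨
    next (σ (σ u))      ≡⟨ cong next (σ² u) ⟩
    next u              ≡⟨ next-u≡v ⟩
    v                   ∎
    where open ≡-Reasoning

  -- On the same decagon `meets` would make `ρ v` a rim neighbour of `v`, but index 2 is no end of
  -- the fan.
  decagon-ρ : ∀ v → decagonAt (ρ v) ≢ decagonAt v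
  decagon-ρ v eq with ends (fan v) (proj₁ (meets (spoke (fan v) 2F) (trans (sym eq) (cong decagonAt (ρ≡w₂ v)))))
  ... | inj₁ p = w-≢ v (λ ()) p
  ... | inj₂ p = w-≢ v (λ ()) p

  -- Within a decagon, next agrees with step everywhere or with its inverse everywhere.
  Forward Backward : V → Set
  Forward  v = step v ≡ next v
  Backward v = step (next v) ≡ v

  forward-next : ∀ {v} → Forward v → Forward (next v)
  forward-next {v} fwd with Rim-next (next v)
  ... | inj₁ p = p
  ... | inj₂ p = ⊥-elim (next²-≢ v (step-injective (trans p (sym fwd))))

  backward-next : ∀ {v} → Backward v → Backward (next v)
  backward-next {v} bwd with Rim-next (next v)
  ... | inj₁ p = ⊥-elim (next²-≢ v (trans (sym p) bwd))
  ... | inj₂ p = p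

  forward-fold : ∀ {v} → Forward v → ∀ i → fold v next i ≡ fold v step i × Forward (fold v next i)
  forward-fold fwd zero    = refl , fwd
  forward-fold fwd (suc i) with forward-fold fwd i
  ... | eq , fwdᵢ = trans (sym fwdᵢ) (cong step eq) , forward-next fwdᵢ

  backward-fold : ∀ {v} → Backward v → ∀ i → fold (fold v next i) step i ≡ v × Backward (fold v next i)
  backward-fold bwd zero    = refl , bwd
  backward-fold {v} bwd (suc i) with backward-fold bwd i
  ... | eq , bwdᵢ = trans (sym (fold-suc step (next (fold v next i)) i)) (trans (cong (λ z → fold z step i) bwdᵢ) eq) ,
                    backward-next bwdᵢ

  laws : Laws rotation
  laws = record
    { next¹⁰ = λ v → [ (λ fwd → trans (proj₁ (forward-fold fwd 10)) (step¹⁰ v))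
                     , (λ bwd → trans (sym (step¹⁰ _)) (proj₁ (backward-fold bwd 10))) ]′ (Rim-next v)
    ; σ² = σ²
    ; ρ³ = ρ³
    ; aperiodic = λ v i eq → step-aperiodic v i
        ([ (λ fwd → trans (sym (proj₁ (forward-fold fwd (suc (toℕ i))))) eq)
         , (λ bwd → trans (cong (λ z → fold z step (suc (toℕ i))) (sym eq)) (proj₁ (backward-fold bwd (suc (toℕ i))))) ]′
         (Rim-next v))
    ; decagonOf = decagonAt
    ; decagonOf-next = λ v → sym (Rim-decagon (Rim-next v))
    ; decagonOf-ρ = decagon-ρ
    }

  Rim-cases : ∀ {x y} → Rim x y → next x ≡ y ⊎ next y ≡ x
  Rim-cases {x} {y} r with ends (fan x) r | previous x
  ... | inj₁ y≡w₀ | _          = inj₁ (sym y≡w₀)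
  ... | inj₂ y≡w₄ | u , next-u = inj₂ (trans (cong next (trans y≡w₄ (sym (next-w₄ next-u)))) next-u)

  edge-Triple : ∀ v → Triple v (next v) (σ v)
  edge-Triple v = spoke (fan v) 0F

  orbit-Triple : ∀ v → Triple v (ρ v) (ρ (ρ v))
  orbit-Triple v = subst₂ (Triple v) (sym (ρ≡w₂ v)) (sym (ρ²≡w₃ v)) (spoke (fan v) 2F)

  -- `P` stands for spanning one fixed face. `Triple` only asserts that some face exists, whereas
  -- the classification of faces has to retain the given one.
  module _ {P : V → V → V → Set} (rotateP : ∀ {x y z} → P x y z → P y z x)
           (exchangeP : ∀ {x y z} → P x y z → P x z y) where

    Spoke : V → Fin 4 → Set
    Spoke v i = P v (w (fan v) (inject₁ i)) (w (fan v) (suc i))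

    Standard : Set
    Standard = ∃[ u ] (P u (next u) (σ u) ⊎ P u (ρ u) (ρ (ρ u)))

    Spoke-standard : ∀ v i → Spoke v i → Standard
    Spoke-standard v 0F p = v , inj₁ p
    Spoke-standard v 1F p = σ v , inj₁ (subst₂ (P (σ v)) (sym (ρ≡w₂ v)) (sym (σ² v)) (rotateP p))
    Spoke-standard v 2F p = v , inj₂ (subst₂ (P v) (sym (ρ≡w₂ v)) (sym (ρ²≡w₃ v)) p)
    Spoke-standard v 3F p with previous v
    ... | u , refl = u , inj₁ (rotateP (rotateP (subst₂ (P (next u)) (sym (σ-w₃ refl)) (sym (next-w₄ refl)) p)))

    Triple-cases : ∀ {v x y} → Triple v x y → P v x y → Standard
    Triple-cases {v} t p with only (fan v) t
    ... | 0F , 1F , here refl , refl , refl = Spoke-standard v 0F p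
    ... | 1F , 0F , here refl , refl , refl = Spoke-standard v 0F (exchangeP p)
    ... | 1F , 0F , there (here ()) , _
    ... | 1F , 2F , there (here refl) , refl , refl = Spoke-standard v 1F p
    ... | 2F , 1F , here refl , refl , refl = Spoke-standard v 1F (exchangeP p)
    ... | 2F , 1F , there (here ()) , _
    ... | 2F , 3F , there (here refl) , refl , refl = Spoke-standard v 2F p
    ... | 3F , 2F , here refl , refl , refl = Spoke-standard v 2F (exchangeP p)
    ... | 3F , 2F , there (here ()) , _
    ... | 3F , 4F , there (here refl) , refl , refl = Spoke-standard v 3F p
    ... | 4F , 3F , here refl , refl , refl = Spoke-standard v 3F (exchangeP p)

-- From polyhedral maps to rotations

module _ {A : Set} where

  Triangle-rotate : {c : List A} {x y z : A} → Triangle c x y z → Triangle c y z x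
  Triangle-rotate (triangle (x∈ ∷ y∈ ∷ z∈ ∷ []) ((x≢y ∷ x≢z ∷ []) ∷ (y≢z ∷ []) ∷ [] ∷ []) size) =
    triangle (y∈ ∷ z∈ ∷ x∈ ∷ []) ((y≢z ∷ ≢-sym x≢y ∷ []) ∷ (≢-sym x≢z ∷ []) ∷ [] ∷ []) size

  Triangle-exchange : {c : List A} {x y z : A} → Triangle c x y z → Triangle c x z y
  Triangle-exchange (triangle (x∈ ∷ y∈ ∷ z∈ ∷ []) ((x≢y ∷ x≢z ∷ []) ∷ (y≢z ∷ []) ∷ [] ∷ []) size) =
    triangle (x∈ ∷ z∈ ∷ y∈ ∷ []) ((x≢z ∷ x≢y ∷ []) ∷ (≢-sym y≢z ∷ []) ∷ [] ∷ []) size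

  Triangle-distinct : {c : List A} {x y z : A} → Triangle c x y z → x ≢ y
  Triangle-distinct t with Triangle.distinct t
  ... | (x≢y ∷ _) ∷ _ = x≢y

  corner-∈ : ∀ {c} {a v b : A} → Corner c a v b → a ∈ c × v ∈ c × b ∈ c
  corner-∈ {c} (inj₁ (av , vb)) = proj₁ (sides-∈ c av) , proj₁ (sides-∈ c vb) , proj₂ (sides-∈ c vb)
  corner-∈ {c} (inj₂ (bv , va)) = proj₂ (sides-∈ c va) , proj₁ (sides-∈ c va) , proj₁ (sides-∈ c bv)

  corner-Triangle : ∀ {c} {a v b : A} → Unique c → length c ≡ 3 → a ≢ b → Corner c a v b → Triangle c v a b
  corner-Triangle {c} {a} {v} {b} unique size a≢b k = triangle (v∈ ∷ a∈ ∷ b∈ ∷ [])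
    ((v≢a k ∷ v≢b k ∷ []) ∷ (a≢b ∷ []) ∷ [] ∷ []) size
    where
    a∈ = proj₁ (corner-∈ k)
    v∈ = proj₁ (proj₂ (corner-∈ k))
    b∈ = proj₂ (proj₂ (corner-∈ k))
    irreflexive : ∀ {x} → (x , x) ∉ sides c
    irreflexive = sides-irreflexive unique (subst (2 ≤_) (sym size) (s≤s (s≤s z≤n)))
    v≢a : Corner c a v b → v ≢ a
    v≢a (inj₁ (s , _)) refl = irreflexive s
    v≢a (inj₂ (_ , s)) refl = irreflexive s
    v≢b : Corner c a v b → v ≢ b
    v≢b (inj₁ (_ , s)) refl = irreflexive s
    v≢b (inj₂ (s , _)) refl = irreflexive s

  ∈-first : ∀ (c : List A) → 3 ≤ length c → ∃[ x ] x ∈ c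
  ∈-first (x ∷ _) _ = x , here refl

  fold-comm : ∀ (f : A → A) x m n → fold (fold x f m) f n ≡ fold (fold x f n) f m
  fold-comm f x m n = trans (sym (fold-+ x f n)) (trans (cong (fold x f) (ℕ.+-comm n m)) (fold-+ x f m))

≡-map⇒Pointwise : {A B : Set} {f : A → B} (xs : List A) {ys : List B} → map f xs ≡ ys →
                  Pointwise (λ x y → f x ≡ y) xs ys
≡-map⇒Pointwise []       refl = []
≡-map⇒Pointwise (x ∷ xs) refl = refl ∷ ≡-map⇒Pointwise xs refl

module Geometry (K : Complex) (isMap : Complex.IsPolyhedralMap K)
                (semiEquivelar : Complex.SemiEquivelar K (3 ∷ 3 ∷ 3 ∷ 3 ∷ 10 ∷ [])) where
  open Complex K
  open IsPolyhedralMap isMap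

  unique : ∀ f → Unique (face f)
  unique f = proj₂ (polygonal f)

  record Around (v : Vertex) : Set where
    field
      w           : Fin 5 → Vertex
      w-injective : ∀ {i j} → w i ≡ w j → i ≡ j
      tri         : Fin 4 → Face
      Triangle-tri : ∀ i → Triangle (face (tri i)) v (w (inject₁ i)) (w (suc i))
      dec         : Face
      dec-size    : length (face dec) ≡ 10
      dec-corner  : Corner (face dec) (w 4F) v (w 0F)
      faces-unique : Unique (tabulate tri ++ dec ∷ [])
      all-faces   : ∀ f → v ∈ face f → f ≡ dec ⊎ ∃[ i ] f ≡ tri i

  abstract
    around : ∀ v → Around v
    around v = go sizes (FaceCycle.link c) (FaceCycle.link-unique c) (FaceCycle.faces-unique c) (FaceCycle.complete c) (FaceCycle.corners c)
      where
      c : FaceCycle v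
      c = proj₁ (semiEquivelar v)

      sizes : Pointwise (λ f m → length (face f) ≡ m) (FaceCycle.faces c) (3 ∷ 3 ∷ 3 ∷ 3 ∷ 10 ∷ [])
      sizes = ≡-map⇒Pointwise (FaceCycle.faces c) (proj₂ (semiEquivelar v))

      go : ∀ {faces} → Pointwise (λ f m → length (face f) ≡ m) faces (3 ∷ 3 ∷ 3 ∷ 3 ∷ 10 ∷ []) →
           ∀ link → Unique link → Unique faces → (∀ f → v ∈ face f → f ∈ faces) →
           Pointwise (λ f (a , b) → Corner (face f) a v b) faces (sides link) → Around v
      go {f₀ ∷ f₁ ∷ f₂ ∷ f₃ ∷ d ∷ []} (s₀ ∷ s₁ ∷ s₂ ∷ s₃ ∷ s₄ ∷ []) link@(a₀ ∷ a₁ ∷ a₂ ∷ a₃ ∷ a₄ ∷ [])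
         link-unique faces-unique complete (k₀ ∷ k₁ ∷ k₂ ∷ k₃ ∷ k₄ ∷ []) = record
        { w = lookup link
        ; w-injective = λ {i} {j} → lookup-injective link-unique i j
        ; tri = lookup (f₀ ∷ f₁ ∷ f₂ ∷ f₃ ∷ [])
        ; Triangle-tri = λ { 0F → corner-Triangle (unique f₀) s₀ (apart 0F) k₀
                           ; 1F → corner-Triangle (unique f₁) s₁ (apart 1F) k₁
                           ; 2F → corner-Triangle (unique f₂) s₂ (apart 2F) k₂
                           ; 3F → corner-Triangle (unique f₃) s₃ (apart 3F) k₃ }
        ; dec = d
        ; dec-size = s₄
        ; dec-corner = k₄
        ; faces-unique = faces-unique
        ; all-faces = λ f v∈f → sort (complete f v∈f)
        }
        where
        apart : ∀ (i : Fin 4) → lookup link (inject₁ i) ≢ lookup link (suc i)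
        apart i eq = ℕ.1+n≢n (sym (trans (sym (Fin.toℕ-inject₁ i))
          (cong toℕ (lookup-injective link-unique (inject₁ i) (suc i) eq))))
        sort : ∀ {f} → f ∈ f₀ ∷ f₁ ∷ f₂ ∷ f₃ ∷ d ∷ [] → f ≡ d ⊎ ∃[ i ] f ≡ lookup (f₀ ∷ f₁ ∷ f₂ ∷ f₃ ∷ []) i
        sort (here p) = inj₂ (0F , p)
        sort (there (here p)) = inj₂ (1F , p)
        sort (there (there (here p))) = inj₂ (2F , p)
        sort (there (there (there (here p)))) = inj₂ (3F , p)
        sort (there (there (there (there (here p))))) = inj₁ p
      -- Five faces need five corners; a link of any other length has the wrong number of sides.
      go (_ ∷ _ ∷ _ ∷ _ ∷ _ ∷ []) []                           _ _ _ ()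
      go (_ ∷ _ ∷ _ ∷ _ ∷ _ ∷ []) (_ ∷ [])                     _ _ _ (_ ∷ ())
      go (_ ∷ _ ∷ _ ∷ _ ∷ _ ∷ []) (_ ∷ _ ∷ [])                 _ _ _ (_ ∷ _ ∷ ())
      go (_ ∷ _ ∷ _ ∷ _ ∷ _ ∷ []) (_ ∷ _ ∷ _ ∷ [])             _ _ _ (_ ∷ _ ∷ _ ∷ ())
      go (_ ∷ _ ∷ _ ∷ _ ∷ _ ∷ []) (_ ∷ _ ∷ _ ∷ _ ∷ [])         _ _ _ (_ ∷ _ ∷ _ ∷ _ ∷ ())
      go (_ ∷ _ ∷ _ ∷ _ ∷ _ ∷ []) (_ ∷ _ ∷ _ ∷ _ ∷ _ ∷ _ ∷ []) _ _ _ (_ ∷ _ ∷ _ ∷ _ ∷ _ ∷ ())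
      go (_ ∷ _ ∷ _ ∷ _ ∷ _ ∷ []) (_ ∷ _ ∷ _ ∷ _ ∷ _ ∷ _ ∷ _ ∷ _) _ _ _ (_ ∷ _ ∷ _ ∷ _ ∷ _ ∷ ())


  decagonAt : Vertex → Face
  decagonAt v = Around.dec (around v)

  decagon-size : ∀ v → length (face (decagonAt v)) ≡ 10
  decagon-size v = Around.dec-size (around v)

  ∈-decagonAt : ∀ v → v ∈ face (decagonAt v)
  ∈-decagonAt v = proj₁ (proj₂ (corner-∈ (Around.dec-corner (around v))))

  decagon-unique : ∀ {f v} → v ∈ face f → length (face f) ≡ 10 → f ≡ decagonAt v
  decagon-unique {f} {v} v∈f size with Around.all-faces (around v) f v∈f
  ... | inj₁ f≡      = f≡
  ... | inj₂ (i , refl) with trans (sym size) (Triangle.size (Around.Triangle-tri (around v) i))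
  ...   | ()

  ∈-decagon : ∀ {v x} → x ∈ face (decagonAt v) → decagonAt x ≡ decagonAt v
  ∈-decagon {v} x∈ = sym (decagon-unique x∈ (decagon-size v))

  decagon-∈ : ∀ {v x} → decagonAt x ≡ decagonAt v → x ∈ face (decagonAt v)
  decagon-∈ {v} {x} eq = subst (λ f → x ∈ face f) eq (∈-decagonAt x)

  abstract
    step : Vertex → Vertex
    step v = proj₁ (∈-sides (∈-decagonAt v))

    step-side : ∀ v → (v , step v) ∈ sides (face (decagonAt v))
    step-side v = proj₂ (∈-sides (∈-decagonAt v))

  step-decagon : ∀ v → decagonAt (step v) ≡ decagonAt v
  step-decagon v = ∈-decagon (proj₂ (sides-∈ (face (decagonAt v)) (step-side v)))

  side-step : ∀ {v x y} → (x , y) ∈ sides (face (decagonAt v)) → step x ≡ y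
  side-step {v} {x} s = sides-functional (unique (decagonAt v))
    (subst (λ f → (x , step x) ∈ sides (face f)) (∈-decagon (proj₁ (sides-∈ (face (decagonAt v)) s))) (step-side x)) s

  step-injective : ∀ {x y} → step x ≡ step y → x ≡ y
  step-injective {x} {y} eq = sides-injective (unique (decagonAt x)) (step-side x)
    (subst₂ (λ z f → (y , z) ∈ sides (face f)) (sym eq) same (step-side y))
    where
    same : decagonAt y ≡ decagonAt x
    same = trans (sym (step-decagon y)) (trans (cong decagonAt (sym eq)) (step-decagon x))

  Rim : Vertex → Vertex → Set
  Rim x y = step x ≡ y ⊎ step y ≡ x

  Side-Rim : ∀ {v x y} → Side (face (decagonAt v)) x y → Rim x y
  Side-Rim = Sum.map side-step side-step

  Rim-Side : ∀ {x y} → Rim x y → Side (face (decagonAt x)) x y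
  Rim-Side {x} (inj₁ refl) = inj₁ (step-side x)
  Rim-Side {y = y} (inj₂ refl) = inj₂ (subst (λ f → (y , step y) ∈ sides (face f)) (sym (step-decagon y)) (step-side y))

  -- The listing of the decagon shows the period at its first vertex; `offset` then moves both
  -- properties along the orbit to `v`.
  record Listed (v : Vertex) : Set where
    field
      first  : Vertex
      offset : ℕ
      reach  : fold first step offset ≡ v
      closed : fold first step 10 ≡ first
      free   : ∀ (i : Fin 9) → fold first step (suc (toℕ i)) ≢ first

  listed : ∀ v → Listed v
  listed v = go (face (decagonAt v)) refl
    where
    go : ∀ c → face (decagonAt v) ≡ c → Listed v
    go [] eq with subst (v ∈_) eq (∈-decagonAt v)
    ... | ()
    go c@(x ∷ xs) eq = record
      { first  = x
      ; offset = toℕ (Any.index v∈c)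
      ; reach  = trans (sym (lookups (Any.index v∈c))) (sym (lookup-index v∈c))
      ; closed = trans (cong (fold x step) (sym size)) closes
      ; free   = λ i fold≡x → free i (lookup-injective (subst Unique eq (unique (decagonAt v))) (index i) zero
                   (trans (lookups (index i)) (trans (cong (fold x step) (toℕ-index i)) fold≡x)))
      }
      where
      v∈c : v ∈ c
      v∈c = subst (v ∈_) eq (∈-decagonAt v)
      size : length c ≡ 10
      size = trans (cong length (sym eq)) (decagon-size v)
      steps : All (λ (a , b) → step a ≡ b) (sides c)
      steps = All.tabulate λ s → side-step {v} (subst (λ c → _ ∈ sides c) (sym eq) s)
      lookups = proj₁ (sides-orbit step x xs steps)
      closes  = proj₂ (sides-orbit step x xs steps)
      bound : ∀ (i : Fin 9) → suc (toℕ i) < length c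
      bound i = subst (suc (toℕ i) <_) (sym size) (s≤s (Fin.toℕ<n i))
      index : Fin 9 → Fin (length c)
      index i = fromℕ< (bound i)
      toℕ-index : ∀ i → toℕ (index i) ≡ suc (toℕ i)
      toℕ-index i = Fin.toℕ-fromℕ< (bound i)
      free : ∀ i → index i ≢ zero
      free i eq with trans (sym (toℕ-index i)) (cong toℕ eq)
      ... | ()

  step¹⁰ : ∀ v → fold v step 10 ≡ v
  step¹⁰ v = subst (λ x → fold x step 10 ≡ x) reach
    (trans (fold-comm step first offset 10) (cong (λ x → fold x step offset) closed))
    where open Listed (listed v)

  step-aperiodic : ∀ v (i : Fin 9) → fold v step (suc (toℕ i)) ≢ v
  step-aperiodic v i eq = free i (fold-cancel step-injective offset
    (trans (fold-comm step first (suc (toℕ i)) offset) (subst (λ x → fold x step (suc (toℕ i)) ≡ x) (sym reach) eq)))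
    where open Listed (listed v)

  Triple : Vertex → Vertex → Vertex → Set
  Triple x y z = ∃[ f ] Triangle (face f) x y z

  two-of : ∀ {x y u v : Vertex} → x ≢ y → x ≡ u ⊎ x ≡ v → y ≡ u ⊎ y ≡ v → (u ≡ x × v ≡ y) ⊎ (u ≡ y × v ≡ x)
  two-of x≢y (inj₁ p) (inj₁ q) = ⊥-elim (x≢y (trans p (sym q)))
  two-of x≢y (inj₁ p) (inj₂ q) = inj₁ (sym p , sym q)
  two-of x≢y (inj₂ p) (inj₁ q) = inj₂ (sym q , sym p)
  two-of x≢y (inj₂ p) (inj₂ q) = ⊥-elim (x≢y (trans p (sym q)))

  -- Polyhedrality for the triangle and the decagon of `x`: with two common vertices they meet in
  -- exactly one edge, which is therefore a side of the decagon and leaves the third corner outside.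
  meets : ∀ {x y z} → Triple x y z → decagonAt x ≡ decagonAt y → Rim x y × decagonAt z ≢ decagonAt x
  meets {x} {y} {z} (f , t@(triangle (x∈ ∷ y∈ ∷ z∈ ∷ []) ((x≢y ∷ x≢z ∷ []) ∷ (y≢z ∷ []) ∷ [] ∷ []) size)) same
    with polyhedral f (decagonAt x) (λ { refl → 3≢10 (trans (sym size) (decagon-size x)) })
    where
    3≢10 : 3 ≢ 10
    3≢10 ()
  ... | inj₁ disjoint = ⊥-elim (disjoint x (x∈ , ∈-decagonAt x))
  ... | inj₂ (inj₁ (v , only)) = ⊥-elim (x≢y
    (trans (to (only x) (x∈ , ∈-decagonAt x)) (sym (to (only y) (y∈ , decagon-∈ (sym same))))))
    where open Equivalence
  ... | inj₂ (inj₂ (u , v , _ , side , only)) =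
    Side-Rim (side-of (two-of x≢y x≡ y≡)) ,
    λ eq → third (two-of x≢y x≡ y≡) (to (only z) (z∈ , decagon-∈ eq))
    where
    open Equivalence
    x≡ : x ≡ u ⊎ x ≡ v
    x≡ = to (only x) (x∈ , ∈-decagonAt x)
    y≡ : y ≡ u ⊎ y ≡ v
    y≡ = to (only y) (y∈ , decagon-∈ (sym same))
    side-of : (u ≡ x × v ≡ y) ⊎ (u ≡ y × v ≡ x) → Side (face (decagonAt x)) x y
    side-of (inj₁ (refl , refl)) = side
    side-of (inj₂ (refl , refl)) = Sum.swap side
    third : (u ≡ x × v ≡ y) ⊎ (u ≡ y × v ≡ x) → z ≡ u ⊎ z ≡ v → ⊥
    third (inj₁ (refl , refl)) (inj₁ refl) = x≢z refl
    third (inj₁ (refl , refl)) (inj₂ refl) = y≢z refl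
    third (inj₂ (refl , refl)) (inj₁ refl) = y≢z refl
    third (inj₂ (refl , refl)) (inj₂ refl) = x≢z refl

  starAt : ∀ v → Fan Triple Rim v
  starAt v = record
    { w = w
    ; w-injective = w-injective
    ; end₀ = Side-Rim {v} (corner-end₀ dec-corner)
    ; end₄ = Side-Rim {v} (corner-end₄ dec-corner)
    ; ends = λ r → corner-ends dec-corner (Rim-Side r)
    ; spoke = λ i → tri i , Triangle-tri i
    ; only = only
    }
    where
    open Around (around v)

    corner-end₀ : Corner (face dec) (w 4F) v (w 0F) → Side (face dec) v (w 0F)
    corner-end₀ (inj₁ (_ , s)) = inj₁ s
    corner-end₀ (inj₂ (s , _)) = inj₂ s

    corner-end₄ : Corner (face dec) (w 4F) v (w 0F) → Side (face dec) v (w 4F)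
    corner-end₄ (inj₁ (s , _)) = inj₂ s
    corner-end₄ (inj₂ (_ , s)) = inj₁ s

    corner-ends : ∀ {x} → Corner (face dec) (w 4F) v (w 0F) → Side (face dec) v x → x ≡ w 0F ⊎ x ≡ w 4F
    corner-ends (inj₁ (_ , s)) (inj₁ s′) = inj₁ (sides-functional (unique dec) s′ s)
    corner-ends (inj₁ (s , _)) (inj₂ s′) = inj₂ (sides-injective (unique dec) s′ s)
    corner-ends (inj₂ (_ , s)) (inj₁ s′) = inj₂ (sides-functional (unique dec) s′ s)
    corner-ends (inj₂ (s , _)) (inj₂ s′) = inj₁ (sides-injective (unique dec) s′ s)

    up : ∀ (i : Fin 4) → suc i ∈ near (inject₁ i)
    up 0F = here refl
    up 1F = there (here refl)
    up 2F = there (here refl)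
    up 3F = there (here refl)

    down : ∀ (i : Fin 4) → inject₁ i ∈ near (suc i)
    down 0F = here refl
    down 1F = here refl
    down 2F = here refl
    down 3F = here refl

    place : ∀ {x y a b} → x ≢ y → x ∈ v ∷ a ∷ b ∷ [] → y ∈ v ∷ a ∷ b ∷ [] → v ≢ x → v ≢ y →
            (x ≡ a × y ≡ b) ⊎ (x ≡ b × y ≡ a)
    place _ (here p) _ v≢x _ = ⊥-elim (v≢x (sym p))
    place _ _ (here q) _ v≢y = ⊥-elim (v≢y (sym q))
    place x≢y (there (here p)) (there (here q)) _ _ = ⊥-elim (x≢y (trans p (sym q)))
    place _ (there (here p)) (there (there (here q))) _ _ = inj₁ (p , q)
    place _ (there (there (here p))) (there (here q)) _ _ = inj₂ (p , q)
    place x≢y (there (there (here p))) (there (there (here q))) _ _ = ⊥-elim (x≢y (trans p (sym q)))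

    only : ∀ {x y} → Triple v x y → ∃₂ λ i j → j ∈ near i × x ≡ w i × y ≡ w j
    only (f , triangle (v∈ ∷ x∈ ∷ y∈ ∷ []) ((v≢x ∷ v≢y ∷ []) ∷ (x≢y ∷ []) ∷ [] ∷ []) size) with all-faces f v∈
    ... | inj₁ refl with trans (sym size) dec-size
    ...   | ()
    only (f , triangle (v∈ ∷ x∈ ∷ y∈ ∷ []) ((v≢x ∷ v≢y ∷ []) ∷ (x≢y ∷ []) ∷ [] ∷ []) size)
      | inj₂ (i , refl) with place x≢y (triangle-∈⁻ (Triangle-tri i) x∈) (triangle-∈⁻ (Triangle-tri i) y∈) v≢x v≢y
    ... | inj₁ (x≡ , y≡) = inject₁ i , suc i , up i , x≡ , y≡
    ... | inj₂ (x≡ , y≡) = suc i , inject₁ i , down i , x≡ , y≡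

  net : Net vertexCount
  net = record
    { Triple = Triple
    ; step = step
    ; decagonAt = decagonAt
    ; rotate = Product.map₂ Triangle-rotate
    ; exchange = Product.map₂ Triangle-exchange
    ; distinct = Triangle-distinct ∘ proj₂
    ; step-injective = step-injective
    ; step¹⁰ = step¹⁰
    ; step-aperiodic = step-aperiodic
    ; step-decagon = step-decagon
    ; meets = meets
    ; fan₀ = starAt
    }

  module N = NetProperties net

  -- The faces of the map in terms of its rotation

  module _ (n≡30 : vertexCount ≡ 30) where
    open Thirty n≡30 N.laws using (same-decagon)
    open LawsProperties N.laws using (decagonOf-fold)
    open Rotation N.rotation using (next; σ; ρ)

    member : ∀ {v x} → x ∈ face (decagonAt v) → Members N.rotation decagon v x
    member x∈ = same-decagon (∈-decagon x∈)

    member⁻ : ∀ {v x} → Members N.rotation decagon v x → x ∈ face (decagonAt v)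
    member⁻ {v} (i , refl) = decagon-∈ (decagonOf-fold v i)

    -- The face may be listed against the direction of `next`, so `oriented-decagon` does not apply.
    -- Its vertices are found through `same-decagon` and its sides through `Rim-cases`.
    decagon-IsFace : ∀ v → IsFace N.rotation decagon v (face (decagonAt v))
    decagon-IsFace v = record { members = λ x → mk⇔ member member⁻ ; sides⇔ = λ x y → mk⇔ to from }
      where
      c = face (decagonAt v)

      ends-∈ : ∀ {x y} → Side c x y → x ∈ c × y ∈ c
      ends-∈ (inj₁ s) = sides-∈ c s
      ends-∈ (inj₂ s) = Product.swap (sides-∈ c s)

      to : ∀ {x y} → Side c x y → Adjacent N.rotation decagon v x y
      to s with N.Rim-cases (Side-Rim {v} s)
      ... | inj₁ p = inj₁ (member (proj₁ (ends-∈ s)) , p)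
      ... | inj₂ p = inj₂ (member (proj₂ (ends-∈ s)) , p)

      next-side : ∀ {x y} → Members N.rotation decagon v x → next x ≡ y → Side c x y
      next-side {x} m refl = subst (λ f → Side (face f) x (next x)) (∈-decagon (member⁻ m)) (Rim-Side (N.Rim-next x))

      from : ∀ {x y} → Adjacent N.rotation decagon v x y → Side c x y
      from (inj₁ (m , p)) = next-side m p
      from (inj₂ (m , p)) = Sum.swap (next-side m p)

    decode-face : ∀ k {v f} → Code N.rotation k v (face f) → IsFace N.rotation k v (face f)
    decode-face k {f = f} = decode N.rotation (Laws.next¹⁰ N.laws) k (unique f)

    geometry-IsSnub : IsSnub K N.rotation
    geometry-IsSnub = record { face⇒ = face⇒ ; face⇐ = face⇐ }
      where
      face⇒ : ∀ f → ∃₂ λ k v → IsFace N.rotation k v (face f)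
      face⇒ f with ∈-first (face f) (proj₁ (polygonal f))
      ... | v , v∈f with Around.all-faces (around v) f v∈f
      ... | inj₁ refl = decagon , v , decagon-IsFace v
      ... | inj₂ (i , refl) with N.Triple-cases Triangle-rotate Triangle-exchange
                                   (f , Around.Triangle-tri (around v) i) (Around.Triangle-tri (around v) i)
      ... | u , inj₁ t = edgeTriangle , u , decode-face edgeTriangle t
      ... | u , inj₂ t = orbitTriangle , u , decode-face orbitTriangle t

      face⇐ : ∀ k v → ∃[ f ] IsFace N.rotation k v (face f)
      face⇐ decagon       v = decagonAt v , decagon-IsFace v
      face⇐ edgeTriangle  v = let f , t = N.edge-Triple v in f , decode-face edgeTriangle t
      face⇐ orbitTriangle v = let f , t = N.orbit-Triple v in f , decode-face orbitTriangle t

-- The number of vertices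

weight : ∀ {P : Set} → Dec P → ℕ → ℕ
weight d k = if does d then k else 0

weight-yes : ∀ {P : Set} (d : Dec P) {k} → P → weight d k ≡ k
weight-yes d {k} p = cong (λ b → if b then k else 0) (dec-true d p)

weight-no : ∀ {P : Set} (d : Dec P) {k} → ¬ P → weight d k ≡ 0
weight-no d {k} ¬p = cong (λ b → if b then k else 0) (dec-false d ¬p)

weight-⇔ : ∀ {P Q : Set} (d : Dec P) (e : Dec Q) {k} → P ⇔ Q → weight d k ≡ weight e k
weight-⇔ d e {k} P⇔Q = cong (λ b → if b then k else 0) (does-⇔ P⇔Q d e)

sum-zero : ∀ n → sum {n} (λ _ → 0) ≡ 0
sum-zero zero    = refl
sum-zero (suc n) = sum-zero n

sum-const : ∀ n k → sum {n} (λ _ → k) ≡ n * k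
sum-const zero    k = refl
sum-const (suc n) k = cong (k +_) (sum-const n k)

sum-select : ∀ {n} (x : Fin n) (g : Fin n → ℕ) → sum (λ j → weight (j Fin.≟ x) (g j)) ≡ g x
sum-select {suc n} zero    g = trans (cong (g zero +_) (sum-zero n)) (ℕ.+-identityʳ (g zero))
sum-select {suc n} (suc x) g = sum-select x (g ∘ suc)

module _ {n : ℕ} where
  open DecMembership (Fin._≟_ {n}) using (_∈?_)

  sum-∈ : ∀ {l} → Unique l → (g : Fin n → ℕ) → sum (λ j → weight (j ∈? l) (g j)) ≡ sumᴸ (map g l)
  sum-∈ {[]}    _  g = sum-zero n
  sum-∈ {x ∷ l} u@(_ ∷ u′) g = begin
    sum (λ j → weight (j ∈? (x ∷ l)) (g j))                        ≡⟨ sum-cong-≗ split ⟩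
    sum (λ j → weight (j Fin.≟ x) (g j) + weight (j ∈? l) (g j))    ≡⟨ ∑-distrib-+ (λ j → weight (j Fin.≟ x) (g j)) _ ⟩
    sum (λ j → weight (j Fin.≟ x) (g j)) + sum (λ j → weight (j ∈? l) (g j))
                                                                    ≡⟨ cong₂ _+_ (sum-select x g) (sum-∈ u′ g) ⟩
    g x + sumᴸ (map g l)                                            ∎
    where
    open ≡-Reasoning
    split : ∀ j → weight (j ∈? (x ∷ l)) (g j) ≡ weight (j Fin.≟ x) (g j) + weight (j ∈? l) (g j)
    split j with j Fin.≟ x
    ... | yes refl = sym (trans (cong (g x +_) (weight-no (j ∈? l) (Unique[x∷xs]⇒x∉xs u))) (ℕ.+-identityʳ (g x)))
    ... | no _     = refl

  sum-listed : ∀ {l} {P : Fin n → Set} (P? : ∀ j → Dec (P j)) → Unique l → (∀ j → P j ⇔ j ∈ l) →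
               (g : Fin n → ℕ) → sum (λ j → weight (P? j) (g j)) ≡ sumᴸ (map g l)
  sum-listed P? u P⇔ g = trans (sum-cong-≗ (λ j → weight-⇔ (P? j) (j ∈? _) (P⇔ j))) (sum-∈ u g)

sumᴸ-tabulate : ∀ {n} (g : Fin n → ℕ) → sumᴸ (tabulate g) ≡ sum g
sumᴸ-tabulate {zero}  g = refl
sumᴸ-tabulate {suc n} g = cong (g zero +_) (sumᴸ-tabulate (g ∘ suc))

module _ {A : Set} {P : A → Set} (P? : ∀ x → Dec (P x)) where

  length-filter : ∀ xs → length (filter P? xs) ≡ sumᴸ (map (λ x → weight (P? x) 1) xs)
  length-filter []       = refl
  length-filter (x ∷ xs) with does (P? x)
  ... | true  = cong suc (length-filter xs)
  ... | false = length-filter xs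

sumᴸ-cartesianProduct : ∀ {A B : Set} (g : A × B → ℕ) xs ys →
  sumᴸ (map g (cartesianProduct xs ys)) ≡ sumᴸ (map (λ x → sumᴸ (map (λ y → g (x , y)) ys)) xs)
sumᴸ-cartesianProduct g []       ys = refl
sumᴸ-cartesianProduct g (x ∷ xs) ys = begin
  sumᴸ (map g (map (x ,_) ys ++ cartesianProduct xs ys))
    ≡⟨ cong sumᴸ (map-++ g (map (x ,_) ys) (cartesianProduct xs ys)) ⟩
  sumᴸ (map g (map (x ,_) ys) ++ map g (cartesianProduct xs ys))
    ≡⟨ sum-++ (map g (map (x ,_) ys)) (map g (cartesianProduct xs ys)) ⟩
  sumᴸ (map g (map (x ,_) ys)) + sumᴸ (map g (cartesianProduct xs ys))
    ≡⟨ cong₂ _+_ (cong sumᴸ (sym (map-∘ ys))) (sumᴸ-cartesianProduct g xs ys) ⟩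
  sumᴸ (map (λ y → g (x , y)) ys) + sumᴸ (map (λ x → sumᴸ (map (λ y → g (x , y)) ys)) xs) ∎
  where open ≡-Reasoning

count-pairs : ∀ {m n} {P : Fin m × Fin n → Set} (P? : ∀ p → Dec (P p)) →
  length (filter P? (cartesianProduct (allFin m) (allFin n))) ≡ sum (λ x → sum (λ y → weight (P? (x , y)) 1))
count-pairs {m} {n} P? = begin
  length (filter P? (cartesianProduct (allFin m) (allFin n)))
    ≡⟨ length-filter P? (cartesianProduct (allFin m) (allFin n)) ⟩
  sumᴸ (map (λ p → weight (P? p) 1) (cartesianProduct (allFin m) (allFin n)))
    ≡⟨ sumᴸ-cartesianProduct (λ p → weight (P? p) 1) (allFin m) (allFin n) ⟩
  sumᴸ (map (λ x → sumᴸ (map (λ y → weight (P? (x , y)) 1) (allFin n))) (allFin m))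
    ≡⟨ over-allFin (λ x → sumᴸ (map (λ y → weight (P? (x , y)) 1) (allFin n))) ⟩
  sum (λ x → sumᴸ (map (λ y → weight (P? (x , y)) 1) (allFin n)))
    ≡⟨ sum-cong-≗ {n = m} (λ x → over-allFin (λ y → weight (P? (x , y)) 1)) ⟩
  sum (λ x → sum (λ y → weight (P? (x , y)) 1)) ∎
  where
  open ≡-Reasoning
  over-allFin : ∀ {n} (g : Fin n → ℕ) → sumᴸ (map g (allFin n)) ≡ sum g
  over-allFin g = trans (cong sumᴸ (map-tabulate id g)) (sumᴸ-tabulate g)

euler-ℕ : ∀ n e f → ℤ.+ n ℤ.- ℤ.+ e ℤ.+ ℤ.+ f ≡ ℤ.- (ℤ.+ 2) → n + f + 2 ≡ e
euler-ℕ n e f eq = ℤ.+-injective (begin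
  ℤ.+ n ℤ.+ ℤ.+ f ℤ.+ ℤ.+ 2                                  ≡⟨ identity (ℤ.+ n) (ℤ.+ e) (ℤ.+ f) ⟩
  (ℤ.+ n ℤ.- ℤ.+ e ℤ.+ ℤ.+ f) ℤ.+ (ℤ.+ e ℤ.+ ℤ.+ 2)          ≡⟨ cong (ℤ._+ (ℤ.+ e ℤ.+ ℤ.+ 2)) eq ⟩
  ℤ.- (ℤ.+ 2) ℤ.+ (ℤ.+ e ℤ.+ ℤ.+ 2)                          ≡⟨ cancel (ℤ.+ e) ⟩
  ℤ.+ e                                                      ∎)
  where
  open ≡-Reasoning
  identity : ∀ a b c → a ℤ.+ c ℤ.+ ℤ.+ 2 ≡ (a ℤ.- b ℤ.+ c) ℤ.+ (b ℤ.+ ℤ.+ 2)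
  identity = solve-∀ᶻ
  cancel : ∀ b → ℤ.- (ℤ.+ 2) ℤ.+ (b ℤ.+ ℤ.+ 2) ≡ b
  cancel = solve-∀ᶻ

-- Multiplying the degree equation by 30 and replacing 30 `f` by 43 `n` gives 150 `n` = 146 `n` +
-- 120, that is 4 `n` = 120.
solve-counts : ∀ n e f → n * 5 ≡ e + e → n * 43 ≡ f * 30 → n + f + 2 ≡ e → n ≡ 30
solve-counts n e f degrees incidences refl = ℕ.*-cancelʳ-≡ n 30 4 (ℕ.+-cancelˡ-≡ (n * 146) (n * 4) 120 (begin
  n * 146 + n * 4                        ≡⟨ collect n ⟩
  30 * (n * 5)                           ≡⟨ cong (30 *_) degrees ⟩
  30 * ((n + f + 2) + (n + f + 2))       ≡⟨ expand n f ⟩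
  n * 60 + 120 + 2 * (f * 30)            ≡⟨ cong (λ k → n * 60 + 120 + 2 * k) incidences ⟨
  n * 60 + 120 + 2 * (n * 43)            ≡⟨ collect′ n ⟩
  n * 146 + 120                          ∎))
  where
  open ≡-Reasoning
  collect : ∀ n → n * 146 + n * 4 ≡ 30 * (n * 5)
  collect = solve-∀
  expand : ∀ n f → 30 * ((n + f + 2) + (n + f + 2)) ≡ n * 60 + 120 + 2 * (f * 30)
  expand = solve-∀
  collect′ : ∀ n → n * 60 + 120 + 2 * (n * 43) ≡ n * 146 + 120
  collect′ = solve-∀

-- Double counting of incidences and edges

module Counting (K : Complex) (isMap : Complex.IsPolyhedralMap K)
                (semiEquivelar : Complex.SemiEquivelar K (3 ∷ 3 ∷ 3 ∷ 3 ∷ 10 ∷ [])) where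
  open Complex K
  open IsPolyhedralMap isMap
  open Geometry K isMap semiEquivelar
  open DecMembership (Fin._≟_ {vertexCount}) using (_∈?_)

  Edge-sym : ∀ {x y} → Edge x y → Edge y x
  Edge-sym (f , s) = f , Sum.swap s

  Edge-irreflexive : ∀ {x} → ¬ Edge x x
  Edge-irreflexive (f , s) = sides-irreflexive (unique f) (ℕ.≤-trans (s≤s (s≤s z≤n)) (proj₁ (polygonal f))) ([ id , id ]′ s)

  module _ (v : Vertex) where
    open Around (around v)

    spoke-Edge : ∀ i {x} → x ∈ w (inject₁ i) ∷ w (suc i) ∷ [] → Edge v x
    spoke-Edge i {x} x∈ = tri i , Equivalence.from (triangle-Side size (unique (tri i)) v x)
      (All.lookup corners (here refl) , All.lookup corners (there x∈) , λ { refl → Unique[x∷xs]⇒x∉xs distinct x∈ })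
      where open Triangle (Triangle-tri i)

    w-Edge : ∀ i → Edge v (w i)
    w-Edge 0F = spoke-Edge 0F (here refl)
    w-Edge 1F = spoke-Edge 0F (there (here refl))
    w-Edge 2F = spoke-Edge 1F (there (here refl))
    w-Edge 3F = spoke-Edge 2F (there (here refl))
    w-Edge 4F = spoke-Edge 3F (there (here refl))

    Edge-w : ∀ {x} → Edge v x → x ∈ tabulate w
    Edge-w {x} e@(f , s) with all-faces f (proj₁ (ends-∈ s))
      where
      ends-∈ : ∀ {c x} → Side c v x → v ∈ c × x ∈ c
      ends-∈ {c} (inj₁ s) = sides-∈ c s
      ends-∈ {c} (inj₂ s) = Product.swap (sides-∈ c s)
    ... | inj₁ refl = [ (λ { refl → ∈-tabulate⁺ {f = w} 0F }) , (λ { refl → ∈-tabulate⁺ {f = w} 4F }) ]′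
                        (Fan.ends (starAt v) (Side-Rim {v} s))
    ... | inj₂ (i , refl) with triangle-∈⁻ (Triangle-tri i)
                                 (proj₁ (proj₂ (Equivalence.to (triangle-Side (Triangle.size (Triangle-tri i)) (unique f) v x) s)))
    ...   | here refl                 = ⊥-elim (Edge-irreflexive e)
    ...   | there (here refl)         = ∈-tabulate⁺ {f = w} (inject₁ i)
    ...   | there (there (here refl)) = ∈-tabulate⁺ {f = w} (suc i)

    degree : sum (λ x → weight (edge? v x) 1) ≡ 5
    degree = sum-listed (edge? v) (tabulate⁺ w-injective)
      (λ x → mk⇔ Edge-w λ x∈ → let i , x≡ = ∈-tabulate⁻ {f = w} x∈ in subst (Edge v) (sym x≡) (w-Edge i)) (λ _ → 1)

    faces-at : List Face
    faces-at = tabulate tri ++ dec ∷ []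

    ∈-faces-at : ∀ {f} → v ∈ face f → f ∈ faces-at
    ∈-faces-at {f} v∈f with all-faces f v∈f
    ... | inj₁ refl       = ∈-++⁺ʳ (tabulate tri) (here refl)
    ... | inj₂ (i , refl) = ∈-++⁺ˡ (∈-tabulate⁺ {f = tri} i)

    faces-at-∈ : ∀ {f} → f ∈ faces-at → v ∈ face f
    faces-at-∈ f∈ with ∈-++⁻ (tabulate tri) f∈
    ... | inj₂ (here refl) = ∈-decagonAt v
    ... | inj₁ f∈tri with ∈-tabulate⁻ {f = tri} f∈tri
    ...   | i , refl = All.lookup (Triangle.corners (Triangle-tri i)) (here refl)

    -- The weight 13 ∸ m of an m-gon is 10 for a triangle and 3 for a decagon: the weights
    -- times sizes are 30 for every face, and they add up to 4 · 10 + 3 around a vertex.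
    weight-at : sum (λ f → weight (v ∈? face f) (13 ∸ length (face f))) ≡ 43
    weight-at = trans (sum-listed (λ f → v ∈? face f) faces-unique (λ f → mk⇔ ∈-faces-at faces-at-∈)
      (λ f → 13 ∸ length (face f)))
      (cong sumᴸ (cong₂ _∷_ (size 0F) (cong₂ _∷_ (size 1F) (cong₂ _∷_ (size 2F) (cong₂ _∷_ (size 3F)
        (cong (λ m → 13 ∸ m ∷ []) (decagon-size v)))))))
      where
      size : ∀ i → 13 ∸ length (face (tri i)) ≡ 10
      size i = cong (13 ∸_) (Triangle.size (Triangle-tri i))

  weight-of : ∀ f → sum (λ v → weight (v ∈? face f) (13 ∸ length (face f))) ≡ 30
  weight-of f = trans (sum-listed (_∈? face f) (unique f) (λ _ → mk⇔ id id) (λ _ → 13 ∸ length (face f)))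
    (trans (sumᴸ-const (face f)) sized)
    where
    sumᴸ-const : ∀ {k} (c : List Vertex) → sumᴸ (map (λ _ → k) c) ≡ length c * k
    sumᴸ-const []      = refl
    sumᴸ-const (_ ∷ c) = cong (_ +_) (sumᴸ-const c)
    sized : length (face f) * (13 ∸ length (face f)) ≡ 30
    sized with ∈-first (face f) (proj₁ (polygonal f))
    ... | v , v∈f with Around.all-faces (around v) f v∈f
    ... | inj₁ refl       = cong (λ m → m * (13 ∸ m)) (decagon-size v)
    ... | inj₂ (i , refl) = cong (λ m → m * (13 ∸ m)) (Triangle.size (Around.Triangle-tri (around v) i))

  -- The weighted incidences are summed by vertices and by faces. Since both kinds of face
  -- contribute 30, triangles and decagons are not counted separately.
  incidences : vertexCount * 43 ≡ faceCount * 30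
  incidences = begin
    vertexCount * 43                                                         ≡⟨ sum-const vertexCount 43 ⟨
    sum {vertexCount} (λ _ → 43)                                             ≡⟨ sum-cong-≗ weight-at ⟨
    sum (λ v → sum (λ f → weight (v ∈? face f) (13 ∸ length (face f))))
      ≡⟨ ∑-comm (λ v f → weight (v ∈? face f) (13 ∸ length (face f))) ⟩
    sum (λ f → sum (λ v → weight (v ∈? face f) (13 ∸ length (face f))))      ≡⟨ sum-cong-≗ weight-of ⟩
    sum {faceCount} (λ _ → 30)                                               ≡⟨ sum-const faceCount 30 ⟩
    faceCount * 30                                                           ∎
    where open ≡-Reasoning

  ordered? : ∀ (e : Vertex × Vertex) → Dec ((proj₁ e Fin.< proj₂ e) × Edge (proj₁ e) (proj₂ e))
  ordered? e = (proj₁ e Fin.<? proj₂ e) ×-dec edge? (proj₁ e) (proj₂ e)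

  -- `edges` puts the smaller endpoint first, so each edge is listed in exactly one of its two
  -- orders.
  edge-split : ∀ x y → weight (edge? x y) 1 ≡ weight (ordered? (x , y)) 1 + weight (ordered? (y , x)) 1
  edge-split x y = go (edge? x y)
    where
    both-ways : ∀ {a b} → weight (ordered? (x , y)) 1 ≡ a → weight (ordered? (y , x)) 1 ≡ b →
          weight (edge? x y) 1 ≡ a + b → weight (edge? x y) 1 ≡ weight (ordered? (x , y)) 1 + weight (ordered? (y , x)) 1
    both-ways p q r = trans r (sym (cong₂ _+_ p q))

    go : Dec (Edge x y) → weight (edge? x y) 1 ≡ weight (ordered? (x , y)) 1 + weight (ordered? (y , x)) 1
    go (no ¬e) = both-ways (weight-no (ordered? (x , y)) (¬e ∘ proj₂)) (weight-no (ordered? (y , x)) (¬e ∘ Edge-sym ∘ proj₂))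
                     (weight-no (edge? x y) ¬e)
    go (yes e) with Fin.<-cmp x y
    ... | tri< x<y _ y≮x = both-ways (weight-yes (ordered? (x , y)) (x<y , e)) (weight-no (ordered? (y , x)) (y≮x ∘ proj₁))
                               (weight-yes (edge? x y) e)
    ... | tri≈ _ refl _  = ⊥-elim (Edge-irreflexive e)
    ... | tri> x≮y _ y<x = both-ways (weight-no (ordered? (x , y)) (x≮y ∘ proj₁)) (weight-yes (ordered? (y , x)) (y<x , Edge-sym e))
                               (weight-yes (edge? x y) e)

  -- The handshake count: after splitting by order, the two double sums agree by exchanging
  -- summation, and each equals the number of edges.
  degrees : vertexCount * 5 ≡ length edges + length edges
  degrees = begin
    vertexCount * 5                                        ≡⟨ sum-const vertexCount 5 ⟨
    sum {vertexCount} (λ _ → 5)                            ≡⟨ sum-cong-≗ degree ⟨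
    sum (λ x → sum (λ y → weight (edge? x y) 1))
      ≡⟨ sum-cong-≗ (λ x → trans (sum-cong-≗ (edge-split x)) (∑-distrib-+ (A x) (λ y → A y x))) ⟩
    sum (λ x → sum (A x) + sum (λ y → A y x))
      ≡⟨ ∑-distrib-+ (λ x → sum (A x)) (λ x → sum (λ y → A y x)) ⟩
    sum (λ x → sum (A x)) + sum (λ x → sum (λ y → A y x))
      ≡⟨ cong (sum (λ x → sum (A x)) +_) (∑-comm (λ x y → A y x)) ⟩
    sum (λ x → sum (A x)) + sum (λ x → sum (A x))
      ≡⟨ cong₂ _+_ (count-pairs ordered?) (count-pairs ordered?) ⟨
    length edges + length edges                            ∎
    where
    open ≡-Reasoning
    A : Vertex → Vertex → ℕ
    A x y = weight (ordered? (x , y)) 1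

  vertexCount≡30 : eulerCharacteristic ≡ ℤ.- (ℤ.+ 2) → vertexCount ≡ 30
  vertexCount≡30 χ = solve-counts vertexCount (length edges) faceCount degrees incidences
    (euler-ℕ vertexCount (length edges) faceCount χ)

open import Data.Integer using (+_; -_)

theorem1p6 : (K : Complex) → let open Complex K in
    IsPolyhedralMap →
    SemiEquivelar (replicate 4 3 ++ replicate 1 10) →
    eulerCharacteristic ≡ - (+ 2) →
    K ≅ 𝒦₁ ⊎ K ≅ 𝒦₂ ⊎ K ≅ 𝒦₃ ⊎ K ≅ 𝒦₄
theorem1p6 K isMap semiEquivelar χ = Sum.map₂ inj₁
  (snub-classification K n≡30 (fromℕ< (IsPolyhedralMap.inhabited isMap)) N.laws (geometry-IsSnub n≡30))
  where
  open Complex K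
  open Geometry K isMap semiEquivelar
  n≡30 : vertexCount ≡ 30
  n≡30 = Counting.vertexCount≡30 K isMap semiEquivelar χ
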